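{- Let $T$ be a theory (a set of sentences of the language of arithmetic). If $T$ is a consistent and recursively axiomatizable extension of Robinson arithmetic $Q$, then $T$ is incomplete, i.e. there is a sentence $\sigma$ such that $T\not\vdash\sigma$ and $T\not\vdash\neg\sigma$.
   Context: Fix a standard first-order language of arithmetic (with equality, constant $0$, unary function symbol $s$, binary function symbols $+,\cdot$, order $\le$ primitive or defined) and a standard Gödel numbering. A theory is an arbitrary set of sentences of this language. $Q$ is Robinson arithmetic, with axioms $s(x)\neq 0$; $s(x)=s(y)\to x=y$; $x\ne0\to\exists y\,(x=s(y))$; $x+0=x$; $x+s(y)=s(x+y)$; $x\cdot 0=0$; $x\cdot s(y)=x\cdot y+x$; $x\le y\leftrightarrow\exists z\,(z+x=y)$. An extension of $Q$ is a theory (in the same language) proving all axioms of $Q$. A theory is recursively axiomatizable if it has the same theorems as some theory whose set of Gödel numbers is recursive. -}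

module Defs where

open import Data.Fin.Base using (Fin; zero; suc; toℕ)
open import Data.List.Base using (List; []; _∷_; map)
open import Data.List.Membership.Propositional using (_∈_)
open import Data.Nat.Base using (ℕ; zero; suc; _+_; _<_)
open import Data.Product.Base using (Σ; ∃; _×_; _,_)
open import Data.Sum.Base using (_⊎_)
open import Data.Vec.Base using (Vec; []; _∷_; lookup)
open import Function.Base using (_∘_)
open import Function.Bundles using (_⇔_)
open import Level using (0ℓ)
open import Relation.Binary.PropositionalEquality.Core using (_≡_)
open import Relation.Nullary.Negation.Core using (¬_)
open import Relation.Unary using (Pred)

infixl 10 _[_]
infixl 9  _·ᵗ_
infixl 8  _+ᵗ_
infix  7  _≐_ _≼_
infix  6  ¬̇_ ∀̇_ ∃̇_
infixr 4  _∧̇_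
infixr 3  _⇒_
infix  2  _⇔̇_
infix  1  _∣_⊢_ _⊢_

-- The first-order language of arithmetic, with well-scoped de Bruijn
-- indices: n bounds the free variables.  The remaining connectives are
-- the usual classical abbreviations.

data Term (n : ℕ) : Set where
  var   : Fin n → Term n
  zeroᵗ : Term n
  sucᵗ  : Term n → Term n
  _+ᵗ_  : Term n → Term n → Term n
  _·ᵗ_  : Term n → Term n → Term n

data Formula (n : ℕ) : Set where
  ⊥̇   : Formula n
  _≐_ : Term n → Term n → Formula n
  _≼_ : Term n → Term n → Formula n
  _⇒_ : Formula n → Formula n → Formula n
  ∀̇_  : Formula (suc n) → Formula n

¬̇_ : ∀ {n} → Formula n → Formula n
¬̇ φ = φ ⇒ ⊥̇

_∧̇_ : ∀ {n} → Formula n → Formula n → Formula n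
φ ∧̇ ψ = ¬̇ (φ ⇒ ¬̇ ψ)

_⇔̇_ : ∀ {n} → Formula n → Formula n → Formula n
φ ⇔̇ ψ = (φ ⇒ ψ) ∧̇ (ψ ⇒ φ)

∃̇_ : ∀ {n} → Formula (suc n) → Formula n
∃̇ φ = ¬̇ (∀̇ (¬̇ φ))

Sentence : Set
Sentence = Formula 0

Theory : Set₁
Theory = Pred Sentence 0ℓ

ext : ∀ {m n} → (Fin m → Fin n) → Fin (suc m) → Fin (suc n)
ext ρ zero    = zero
ext ρ (suc i) = suc (ρ i)

renameᵗ : ∀ {m n} → (Fin m → Fin n) → Term m → Term n
renameᵗ ρ (var i)  = var (ρ i)
renameᵗ ρ zeroᵗ    = zeroᵗ
renameᵗ ρ (sucᵗ t) = sucᵗ (renameᵗ ρ t)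
renameᵗ ρ (s +ᵗ t) = renameᵗ ρ s +ᵗ renameᵗ ρ t
renameᵗ ρ (s ·ᵗ t) = renameᵗ ρ s ·ᵗ renameᵗ ρ t

rename : ∀ {m n} → (Fin m → Fin n) → Formula m → Formula n
rename ρ ⊥̇       = ⊥̇
rename ρ (s ≐ t) = renameᵗ ρ s ≐ renameᵗ ρ t
rename ρ (s ≼ t) = renameᵗ ρ s ≼ renameᵗ ρ t
rename ρ (φ ⇒ ψ) = rename ρ φ ⇒ rename ρ ψ
rename ρ (∀̇ φ)   = ∀̇ rename (ext ρ) φ

exts : ∀ {m n} → (Fin m → Term n) → Fin (suc m) → Term (suc n)
exts θ zero    = var zero
exts θ (suc i) = renameᵗ suc (θ i)

substᵗ : ∀ {m n} → (Fin m → Term n) → Term m → Term n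
substᵗ θ (var i)  = θ i
substᵗ θ zeroᵗ    = zeroᵗ
substᵗ θ (sucᵗ t) = sucᵗ (substᵗ θ t)
substᵗ θ (s +ᵗ t) = substᵗ θ s +ᵗ substᵗ θ t
substᵗ θ (s ·ᵗ t) = substᵗ θ s ·ᵗ substᵗ θ t

subst : ∀ {m n} → (Fin m → Term n) → Formula m → Formula n
subst θ ⊥̇       = ⊥̇
subst θ (s ≐ t) = substᵗ θ s ≐ substᵗ θ t
subst θ (s ≼ t) = substᵗ θ s ≼ substᵗ θ t
subst θ (φ ⇒ ψ) = subst θ φ ⇒ subst θ ψ
subst θ (∀̇ φ)   = ∀̇ subst (exts θ) φ

single : ∀ {n} → Term n → Fin (suc n) → Term n
single t zero    = t
single t (suc i) = var i

_[_] : ∀ {n} → Formula (suc n) → Term n → Formula n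
φ [ t ] = subst (single t) φ

weaken : ∀ {n} → Formula n → Formula (suc n)
weaken = rename suc

embed : ∀ {n} → Sentence → Formula n
embed = rename (λ ())

-- Natural deduction for classical first-order logic with equality.  The
-- theory T supplies axioms; Γ lists the undischarged hypotheses.

data _∣_⊢_ (T : Theory) {n : ℕ} (Γ : List (Formula n)) : Formula n → Set where
  axiom : ∀ {σ} → T σ → T ∣ Γ ⊢ embed σ
  hyp   : ∀ {φ} → φ ∈ Γ → T ∣ Γ ⊢ φ
  ⇒I    : ∀ {φ ψ} → T ∣ φ ∷ Γ ⊢ ψ → T ∣ Γ ⊢ φ ⇒ ψ
  ⇒E    : ∀ {φ ψ} → T ∣ Γ ⊢ φ ⇒ ψ → T ∣ Γ ⊢ φ → T ∣ Γ ⊢ ψ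
  raa   : ∀ {φ} → T ∣ ¬̇ φ ∷ Γ ⊢ ⊥̇ → T ∣ Γ ⊢ φ
  ∀I    : ∀ {φ} → T ∣ map weaken Γ ⊢ φ → T ∣ Γ ⊢ ∀̇ φ
  ∀E    : ∀ {φ} → T ∣ Γ ⊢ ∀̇ φ → (t : Term n) → T ∣ Γ ⊢ φ [ t ]
  ≐I    : ∀ t → T ∣ Γ ⊢ t ≐ t
  ≐E    : ∀ {s t} φ → T ∣ Γ ⊢ s ≐ t → T ∣ Γ ⊢ φ [ s ] → T ∣ Γ ⊢ φ [ t ]

_⊢_ : Theory → Sentence → Set
T ⊢ σ = T ∣ [] ⊢ σ

Consistent : Theory → Set
Consistent T = ¬ (T ⊢ ⊥̇)

-- Robinson arithmetic, each axiom universally closed.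

private
  x₀ : ∀ {n} → Term (1 + n)
  x₀ = var zero

  x₁ : ∀ {n} → Term (2 + n)
  x₁ = var (suc zero)

  x₂ : ∀ {n} → Term (3 + n)
  x₂ = var (suc (suc zero))

data Q : Theory where
  suc≢0   : Q (∀̇ ¬̇ (sucᵗ x₀ ≐ zeroᵗ))
  suc-inj : Q (∀̇ ∀̇ (sucᵗ x₁ ≐ sucᵗ x₀ ⇒ x₁ ≐ x₀))
  pred    : Q (∀̇ (¬̇ (x₀ ≐ zeroᵗ) ⇒ ∃̇ (x₁ ≐ sucᵗ x₀)))
  +-zero  : Q (∀̇ (x₀ +ᵗ zeroᵗ ≐ x₀))
  +-suc   : Q (∀̇ ∀̇ (x₁ +ᵗ sucᵗ x₀ ≐ sucᵗ (x₁ +ᵗ x₀)))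
  ·-zero  : Q (∀̇ (x₀ ·ᵗ zeroᵗ ≐ zeroᵗ))
  ·-suc   : Q (∀̇ ∀̇ (x₁ ·ᵗ sucᵗ x₀ ≐ x₁ ·ᵗ x₀ +ᵗ x₁))
  ≤-def   : Q (∀̇ ∀̇ (x₁ ≼ x₀ ⇔̇ ∃̇ (x₀ +ᵗ x₂ ≐ x₁)))

_Extends_ : Theory → Theory → Set
T Extends S = ∀ σ → S σ → T ⊢ σ

-- Partial recursive functions: Kleene's schemes and their evaluation.

data Code : ℕ → Set where
  zeroᶜ : Code 0
  sucᶜ  : Code 1
  proj  : ∀ {n} → Fin n → Code n
  comp  : ∀ {m n} → Code m → Vec (Code n) m → Code n
  prec  : ∀ {n} → Code n → Code (2 + n) → Code (1 + n)
  μ     : ∀ {n} → Code (1 + n) → Code n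

infix 1 _⟨_⟩↓_ _⟨_⟩⇊_

mutual

  data _⟨_⟩↓_ : ∀ {n} → Code n → Vec ℕ n → ℕ → Set where
    ↓zero : zeroᶜ ⟨ [] ⟩↓ 0
    ↓suc  : ∀ {x} → sucᶜ ⟨ x ∷ [] ⟩↓ suc x
    ↓proj : ∀ {n} {xs : Vec ℕ n} i → proj i ⟨ xs ⟩↓ lookup xs i
    ↓comp : ∀ {m n} {f : Code m} {gs : Vec (Code n) m} {xs ys z} →
            gs ⟨ xs ⟩⇊ ys → f ⟨ ys ⟩↓ z → comp f gs ⟨ xs ⟩↓ z
    ↓prec-zero : ∀ {n} {f : Code n} {g xs z} →
            f ⟨ xs ⟩↓ z → prec f g ⟨ 0 ∷ xs ⟩↓ z
    ↓prec-suc : ∀ {n} {f : Code n} {g k xs y z} →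
            prec f g ⟨ k ∷ xs ⟩↓ y → g ⟨ k ∷ y ∷ xs ⟩↓ z →
            prec f g ⟨ suc k ∷ xs ⟩↓ z
    ↓μ    : ∀ {n} {f : Code (1 + n)} {xs k} →
            (∀ i → i < k → ∃ λ y → f ⟨ i ∷ xs ⟩↓ suc y) →
            f ⟨ k ∷ xs ⟩↓ 0 → μ f ⟨ xs ⟩↓ k

  data _⟨_⟩⇊_ {n : ℕ} : ∀ {m} → Vec (Code n) m → Vec ℕ n → Vec ℕ m → Set where
    []  : ∀ {xs} → [] ⟨ xs ⟩⇊ []
    _∷_ : ∀ {m g xs y} {gs : Vec (Code n) m} {ys} →
          g ⟨ xs ⟩↓ y → gs ⟨ xs ⟩⇊ ys → (g ∷ gs) ⟨ xs ⟩⇊ (y ∷ ys)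

-- The characteristic function of P is recursive.

Recursive : Pred ℕ 0ℓ → Set
Recursive P = Σ (Code 1) λ f → ∀ n →
  (P n × (f ⟨ n ∷ [] ⟩↓ 1)) ⊎ (¬ P n × (f ⟨ n ∷ [] ⟩↓ 0))

triangle : ℕ → ℕ
triangle zero    = 0
triangle (suc n) = suc n + triangle n

-- Cantor's pairing function, a bijection ℕ × ℕ → ℕ.

pair : ℕ → ℕ → ℕ
pair a b = triangle (a + b) + b

-- Gödel numbering: a tag for the head symbol paired with the codes of the
-- immediate subexpressions.

⌜_⌝ᵗ : ∀ {n} → Term n → ℕ
⌜ var i ⌝ᵗ  = pair 0 (toℕ i)
⌜ zeroᵗ ⌝ᵗ  = pair 1 0
⌜ sucᵗ t ⌝ᵗ = pair 2 ⌜ t ⌝ᵗ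
⌜ s +ᵗ t ⌝ᵗ = pair 3 (pair ⌜ s ⌝ᵗ ⌜ t ⌝ᵗ)
⌜ s ·ᵗ t ⌝ᵗ = pair 4 (pair ⌜ s ⌝ᵗ ⌜ t ⌝ᵗ)

⌜_⌝ : ∀ {n} → Formula n → ℕ
⌜ ⊥̇ ⌝     = pair 0 0
⌜ s ≐ t ⌝ = pair 1 (pair ⌜ s ⌝ᵗ ⌜ t ⌝ᵗ)
⌜ s ≼ t ⌝ = pair 2 (pair ⌜ s ⌝ᵗ ⌜ t ⌝ᵗ)
⌜ φ ⇒ ψ ⌝ = pair 3 (pair ⌜ φ ⌝ ⌜ ψ ⌝)
⌜ ∀̇ φ ⌝   = pair 4 ⌜ φ ⌝

GödelNumbers : Theory → Pred ℕ 0ℓ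
GödelNumbers A n = ∃ λ σ → A σ × ⌜ σ ⌝ ≡ n

RecursivelyAxiomatizable : Theory → Set₁
RecursivelyAxiomatizable T =
  Σ Theory λ A → Recursive (GödelNumbers A) × (∀ σ → (T ⊢ σ) ⇔ (A ⊢ σ))

{-# OPTIONS --safe #-}

-- The Gödel–Rosser argument.  Provability is generated by finitely many Horn clauses over ℕ; derivability from
-- such clauses is Σ₁, since a derivation is a finite set of ranked facts, coded by the divisors 1 + (p + 1) d of a
-- number c.  An extension of Q decides every formula whose quantifiers are bounded by a numeral.  Rosser's sentence
-- R(r) says that each witness of the provability of R(r) has a witness of its refutability at or below it.  A proof
-- of R(r), or of its negation, would then make T prove both.

module Submission where

open import Defs
open import Data.Empty using (⊥; ⊥-elim)
open import Data.Fin using (#_)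
open import Data.Fin.Base using (Fin; zero; suc; toℕ; _↑ˡ_; _↑ʳ_)
open import Data.Fin.Properties using (toℕ-injective)
open import Data.List.Base using (List; []; _∷_; map) renaming (_++_ to _++ˡ_; lookup to lookupˡ)
open import Data.List.Membership.Propositional using (_∈_; find; lose)
open import Data.List.Membership.Propositional.Properties
  using (∈-map⁺; ∈-map⁻; ∈-++⁺ˡ; ∈-++⁺ʳ; ∈-++⁻; ∈-lookup)
open import Data.List.Relation.Unary.All as All using (All; []; _∷_)
open import Data.List.Relation.Unary.Any as Any using (Any; here; there)
open import Data.Nat.Base using (ℕ; zero; suc; _+_; _*_; _≤_; _<_; z≤n; s≤s; _!; ≢-nonZero⁻¹)
open import Data.Nat.Coprimality using (Coprime; coprime-divisor) renaming (sym to coprime-sym)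
open import Data.Nat.Divisibility
  using (divides; ∣-trans; ∣1⇒≡1; ∣m+n∣m⇒∣n; ∣n⇒∣m*n; m∣m*n; m≤n⇒m!∣n!) renaming (_∣_ to _∣ℕ_)
open import Data.Nat.Induction using (<-rec)
open import Data.Nat.ListAction using (sum; product)
open import Data.Nat.Properties
  using ( _≟_; _≤?_; anyUpTo?; <-cmp; ≤-refl; ≤-trans; <-irrefl; suc-injective; m≤n⇒m≤1+n; m≤n⇒m<n∨m≡n
        ; m≤n⇒∃[o]m+o≡n; m≤m+n; m≤n+m; m+n≤o⇒m≤o; m+n≤o⇒n≤o; m≤m*n; m*n≢0; _!≢0
        ; +-comm; +-identityʳ; +-mono-≤; +-monoʳ-≤; +-cancelˡ-≡; +-cancelʳ-≡
        ; *-comm; *-assoc; *-suc; *-zeroʳ; *-cancelˡ-≡; module ≤-Reasoning )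
  renaming (+-suc to ℕ-+-suc)
open import Data.List.Membership.DecPropositional _≟_ using (_∈?_)
open import Data.Nat.Solver using (module +-*-Solver)
open import Data.Product.Base using (∃; _×_; _,_; proj₁; proj₂)
open import Data.Sum.Base using (_⊎_; inj₁; inj₂)
open import Data.Vec.Base using (Vec; []; _∷_; _++_; lookup; toList)
open import Data.Vec.Properties using (lookup-++ˡ; lookup-++ʳ)
open import Function.Base using (_∘_; id; case_of_)
open import Function.Bundles using (module Equivalence; _⇔_; mk⇔)
open import Relation.Binary.Definitions using (tri<; tri≈; tri>)
open import Relation.Binary.PropositionalEquality
  using (_≡_; _≢_; refl; sym; trans; cong; cong₂; module ≡-Reasoning) renaming (subst to transport)
open import Relation.Nullary using (¬_; Dec; yes; no)
open import Relation.Nullary.Decidable using (¬?; _→-dec_; decidable-stable)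

-- A witness here is not the code of a proof but a number w that bounds every quantifier of a Σ₁
-- formula at once. The same w thus yields a sentence that `T` decides and serves as the quantity
-- that Rosser's sentence compares. The argument needs one true instance on one side and the falsity
-- of all instances on the other; hence soundness is required at every bound, while completeness is
-- required only from some bound on.
--
-- Horn clauses make the arithmetization uniform: substitution, provability and the evaluation of
-- recursive functions belong to one inductive definition, so the Σ₁ form has to be found only once,
-- and the representability of recursive functions is not a separate step. What has to be coded is a
-- finite set rather than a sequence, so divisibility takes the place of Gödel's β-function.
--
-- The metatheory is constructive. Truth below a bound is decidable, and this stands in for excluded
-- middle wherever the object language is classical.

infix 4 _⊆ʳ[_]_

-- Algebra of renaming and substitution.

substᵗ-cong : ∀ {m n} {θ θ′ : Fin m → Term n} → (∀ i → θ i ≡ θ′ i) → ∀ t → substᵗ θ t ≡ substᵗ θ′ t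
substᵗ-cong eq (var i)  = eq i
substᵗ-cong eq zeroᵗ    = refl
substᵗ-cong eq (sucᵗ t) = cong sucᵗ (substᵗ-cong eq t)
substᵗ-cong eq (s +ᵗ t) = cong₂ _+ᵗ_ (substᵗ-cong eq s) (substᵗ-cong eq t)
substᵗ-cong eq (s ·ᵗ t) = cong₂ _·ᵗ_ (substᵗ-cong eq s) (substᵗ-cong eq t)

exts-cong : ∀ {m n} {θ θ′ : Fin m → Term n} → (∀ i → θ i ≡ θ′ i) → ∀ i → exts θ i ≡ exts θ′ i
exts-cong eq zero    = refl
exts-cong eq (suc i) = cong (renameᵗ suc) (eq i)

subst-cong : ∀ {m n} {θ θ′ : Fin m → Term n} → (∀ i → θ i ≡ θ′ i) → ∀ φ → subst θ φ ≡ subst θ′ φ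
subst-cong eq ⊥̇       = refl
subst-cong eq (s ≐ t) = cong₂ _≐_ (substᵗ-cong eq s) (substᵗ-cong eq t)
subst-cong eq (s ≼ t) = cong₂ _≼_ (substᵗ-cong eq s) (substᵗ-cong eq t)
subst-cong eq (φ ⇒ ψ) = cong₂ _⇒_ (subst-cong eq φ) (subst-cong eq ψ)
subst-cong eq (∀̇ φ)   = cong ∀̇_ (subst-cong (exts-cong eq) φ)

substᵗ-renameᵗ : ∀ {l m n} (θ : Fin m → Term n) (π : Fin l → Fin m) t →
  substᵗ θ (renameᵗ π t) ≡ substᵗ (θ ∘ π) t
substᵗ-renameᵗ θ π (var i)  = refl
substᵗ-renameᵗ θ π zeroᵗ    = refl
substᵗ-renameᵗ θ π (sucᵗ t) = cong sucᵗ (substᵗ-renameᵗ θ π t)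
substᵗ-renameᵗ θ π (s +ᵗ t) = cong₂ _+ᵗ_ (substᵗ-renameᵗ θ π s) (substᵗ-renameᵗ θ π t)
substᵗ-renameᵗ θ π (s ·ᵗ t) = cong₂ _·ᵗ_ (substᵗ-renameᵗ θ π s) (substᵗ-renameᵗ θ π t)

exts-ext : ∀ {l m n} (θ : Fin m → Term n) (π : Fin l → Fin m) i → exts θ (ext π i) ≡ exts (θ ∘ π) i
exts-ext θ π zero    = refl
exts-ext θ π (suc i) = refl

subst-rename : ∀ {l m n} (θ : Fin m → Term n) (π : Fin l → Fin m) φ →
  subst θ (rename π φ) ≡ subst (θ ∘ π) φ
subst-rename θ π ⊥̇       = refl
subst-rename θ π (s ≐ t) = cong₂ _≐_ (substᵗ-renameᵗ θ π s) (substᵗ-renameᵗ θ π t)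
subst-rename θ π (s ≼ t) = cong₂ _≼_ (substᵗ-renameᵗ θ π s) (substᵗ-renameᵗ θ π t)
subst-rename θ π (φ ⇒ ψ) = cong₂ _⇒_ (subst-rename θ π φ) (subst-rename θ π ψ)
subst-rename θ π (∀̇ φ)   = cong ∀̇_ (trans (subst-rename _ _ φ) (subst-cong (exts-ext θ π) φ))

renameᵗ-substᵗ : ∀ {l m n} (ρ : Fin m → Fin n) (θ : Fin l → Term m) t →
  renameᵗ ρ (substᵗ θ t) ≡ substᵗ (renameᵗ ρ ∘ θ) t
renameᵗ-substᵗ ρ θ (var i)  = refl
renameᵗ-substᵗ ρ θ zeroᵗ    = refl
renameᵗ-substᵗ ρ θ (sucᵗ t) = cong sucᵗ (renameᵗ-substᵗ ρ θ t)
renameᵗ-substᵗ ρ θ (s +ᵗ t) = cong₂ _+ᵗ_ (renameᵗ-substᵗ ρ θ s) (renameᵗ-substᵗ ρ θ t)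
renameᵗ-substᵗ ρ θ (s ·ᵗ t) = cong₂ _·ᵗ_ (renameᵗ-substᵗ ρ θ s) (renameᵗ-substᵗ ρ θ t)

substᵗ-∘ : ∀ {l m n} (η : Fin m → Term n) (θ : Fin l → Term m) t →
  substᵗ η (substᵗ θ t) ≡ substᵗ (substᵗ η ∘ θ) t
substᵗ-∘ η θ (var i)  = refl
substᵗ-∘ η θ zeroᵗ    = refl
substᵗ-∘ η θ (sucᵗ t) = cong sucᵗ (substᵗ-∘ η θ t)
substᵗ-∘ η θ (s +ᵗ t) = cong₂ _+ᵗ_ (substᵗ-∘ η θ s) (substᵗ-∘ η θ t)
substᵗ-∘ η θ (s ·ᵗ t) = cong₂ _·ᵗ_ (substᵗ-∘ η θ s) (substᵗ-∘ η θ t)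

exts-∘ : ∀ {l m n} (η : Fin m → Term n) (θ : Fin l → Term m) i →
  substᵗ (exts η) (exts θ i) ≡ exts (substᵗ η ∘ θ) i
exts-∘ η θ zero    = refl
exts-∘ η θ (suc i) = trans (substᵗ-renameᵗ (exts η) suc (θ i)) (sym (renameᵗ-substᵗ suc η (θ i)))

subst-∘ : ∀ {l m n} (η : Fin m → Term n) (θ : Fin l → Term m) φ →
  subst η (subst θ φ) ≡ subst (substᵗ η ∘ θ) φ
subst-∘ η θ ⊥̇       = refl
subst-∘ η θ (s ≐ t) = cong₂ _≐_ (substᵗ-∘ η θ s) (substᵗ-∘ η θ t)
subst-∘ η θ (s ≼ t) = cong₂ _≼_ (substᵗ-∘ η θ s) (substᵗ-∘ η θ t)
subst-∘ η θ (φ ⇒ ψ) = cong₂ _⇒_ (subst-∘ η θ φ) (subst-∘ η θ ψ)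
subst-∘ η θ (∀̇ φ)   = cong ∀̇_ (trans (subst-∘ _ _ φ) (subst-cong (exts-∘ η θ) φ))

substᵗ-var : ∀ {n} (t : Term n) → substᵗ var t ≡ t
substᵗ-var (var i)  = refl
substᵗ-var zeroᵗ    = refl
substᵗ-var (sucᵗ t) = cong sucᵗ (substᵗ-var t)
substᵗ-var (s +ᵗ t) = cong₂ _+ᵗ_ (substᵗ-var s) (substᵗ-var t)
substᵗ-var (s ·ᵗ t) = cong₂ _·ᵗ_ (substᵗ-var s) (substᵗ-var t)

exts-var : ∀ {n} (i : Fin (suc n)) → exts var i ≡ var i
exts-var zero    = refl
exts-var (suc i) = refl

subst-var : ∀ {n} (φ : Formula n) → subst var φ ≡ φ
subst-var ⊥̇       = refl
subst-var (s ≐ t) = cong₂ _≐_ (substᵗ-var s) (substᵗ-var t)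
subst-var (s ≼ t) = cong₂ _≼_ (substᵗ-var s) (substᵗ-var t)
subst-var (φ ⇒ ψ) = cong₂ _⇒_ (subst-var φ) (subst-var ψ)
subst-var (∀̇ φ)   = cong ∀̇_ (trans (subst-cong exts-var φ) (subst-var φ))

renameᵗ≡substᵗ : ∀ {m n} (ρ : Fin m → Fin n) t → renameᵗ ρ t ≡ substᵗ (var ∘ ρ) t
renameᵗ≡substᵗ ρ t = trans (sym (substᵗ-var _)) (substᵗ-renameᵗ var ρ t)

rename≡subst : ∀ {m n} (ρ : Fin m → Fin n) φ → rename ρ φ ≡ subst (var ∘ ρ) φ
rename≡subst ρ φ = trans (sym (subst-var _)) (subst-rename var ρ φ)

rename-subst : ∀ {l m n} (ρ : Fin m → Fin n) (θ : Fin l → Term m) φ →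
  rename ρ (subst θ φ) ≡ subst (renameᵗ ρ ∘ θ) φ
rename-subst ρ θ φ = trans (rename≡subst ρ _) (trans (subst-∘ _ θ φ)
  (subst-cong (λ i → sym (renameᵗ≡substᵗ ρ (θ i))) φ))

substᵗ-single-suc : ∀ {n} (s t : Term n) → substᵗ (single s) (renameᵗ suc t) ≡ t
substᵗ-single-suc s t = trans (substᵗ-renameᵗ _ suc t) (substᵗ-var t)

rename-[] : ∀ {m n} (ρ : Fin m → Fin n) φ t → rename ρ (φ [ t ]) ≡ rename (ext ρ) φ [ renameᵗ ρ t ]
rename-[] ρ φ t = trans (rename-subst ρ (single t) φ)
  (trans (subst-cong eq φ) (sym (subst-rename _ (ext ρ) φ)))
  where
  eq : ∀ i → renameᵗ ρ (single t i) ≡ single (renameᵗ ρ t) (ext ρ i)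
  eq zero    = refl
  eq (suc i) = refl

embed≡subst : ∀ {n} (θ : Fin 0 → Term n) σ → embed σ ≡ subst θ σ
embed≡subst θ σ = trans (rename≡subst _ σ) (subst-cong (λ ()) σ)

subst-embed : ∀ {m n} (θ : Fin m → Term n) σ → subst θ (embed σ) ≡ embed σ
subst-embed θ σ = trans (subst-rename θ _ σ) (sym (embed≡subst _ σ))

rename-embed : ∀ {m n} (ρ : Fin m → Fin n) σ → rename ρ (embed σ) ≡ embed σ
rename-embed ρ σ = trans (rename≡subst ρ _) (subst-embed _ σ)

rename-ext-weaken : ∀ {m n} (ρ : Fin m → Fin n) φ → rename (ext ρ) (weaken φ) ≡ weaken (rename ρ φ)
rename-ext-weaken ρ φ = trans (rename≡subst (ext ρ) _) (trans (subst-rename _ suc φ)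
  (sym (trans (cong weaken (rename≡subst ρ φ)) (rename-subst suc _ φ))))

rename-id : ∀ {n} (φ : Formula n) → rename id φ ≡ φ
rename-id φ = trans (rename≡subst id φ) (subst-var φ)

-- Structural rules of the calculus.

-- Phrased by membership, so that the single induction `rename-⊢` covers the renaming of variables
-- together with weakening, exchange and contraction of hypotheses.
_⊆ʳ[_]_ : ∀ {m n} → List (Formula m) → (Fin m → Fin n) → List (Formula n) → Set
Γ ⊆ʳ[ ρ ] Δ = ∀ {ψ} → ψ ∈ Γ → rename ρ ψ ∈ Δ

⊆ʳ-∷ : ∀ {m n Γ Δ} {ρ : Fin m → Fin n} φ → Γ ⊆ʳ[ ρ ] Δ → (φ ∷ Γ) ⊆ʳ[ ρ ] (rename ρ φ ∷ Δ)
⊆ʳ-∷ φ r (here refl) = here refl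
⊆ʳ-∷ φ r (there p)   = there (r p)

⊆ʳ-weaken : ∀ {m n Γ Δ} {ρ : Fin m → Fin n} → Γ ⊆ʳ[ ρ ] Δ → map weaken Γ ⊆ʳ[ ext ρ ] map weaken Δ
⊆ʳ-weaken {ρ = ρ} r p with ∈-map⁻ weaken p
... | φ , q , refl = transport (_∈ _) (sym (rename-ext-weaken ρ φ)) (∈-map⁺ weaken (r q))

rename-⊢ : ∀ {T m n Γ Δ φ} {ρ : Fin m → Fin n} → Γ ⊆ʳ[ ρ ] Δ → T ∣ Γ ⊢ φ → T ∣ Δ ⊢ rename ρ φ
rename-⊢ {ρ = ρ} r (axiom {σ} a) = transport (_ ∣ _ ⊢_) (sym (rename-embed ρ σ)) (axiom a)
rename-⊢ r (hyp p)               = hyp (r p)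
rename-⊢ r (⇒I {φ} d)            = ⇒I (rename-⊢ (⊆ʳ-∷ φ r) d)
rename-⊢ r (⇒E d e)              = ⇒E (rename-⊢ r d) (rename-⊢ r e)
rename-⊢ r (raa {φ} d)           = raa (rename-⊢ (⊆ʳ-∷ (¬̇ φ) r) d)
rename-⊢ r (∀I d)                = ∀I (rename-⊢ (⊆ʳ-weaken r) d)
rename-⊢ {ρ = ρ} r (∀E {φ} d t)  =
  transport (_ ∣ _ ⊢_) (sym (rename-[] ρ φ t)) (∀E (rename-⊢ r d) (renameᵗ ρ t))
rename-⊢ r (≐I t)                = ≐I _
rename-⊢ {ρ = ρ} r (≐E {s} {t} φ d e) = transport (_ ∣ _ ⊢_) (sym (rename-[] ρ φ t))
  (≐E (rename (ext ρ) φ) (rename-⊢ r d) (transport (_ ∣ _ ⊢_) (rename-[] ρ φ s) (rename-⊢ r e)))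

weaken-⊢ : ∀ {T n Γ Δ} {φ : Formula n} → (∀ {ψ} → ψ ∈ Γ → ψ ∈ Δ) → T ∣ Γ ⊢ φ → T ∣ Δ ⊢ φ
weaken-⊢ r d = transport (_ ∣ _ ⊢_) (rename-id _)
  (rename-⊢ (λ p → transport (_∈ _) (sym (rename-id _)) (r p)) d)

embed-⊢ : ∀ {T σ n} {Γ : List (Formula n)} → T ⊢ σ → T ∣ Γ ⊢ embed σ
embed-⊢ = rename-⊢ λ ()

-- Derived rules for the classical connectives and equality.

⊥E : ∀ {T n Γ} {φ : Formula n} → T ∣ Γ ⊢ ⊥̇ → T ∣ Γ ⊢ φ
⊥E d = raa (weaken-⊢ there d)

⊢-byCases : ∀ {T n Γ} (φ : Formula n) {ψ} → T ∣ φ ∷ Γ ⊢ ψ → T ∣ ¬̇ φ ∷ Γ ⊢ ψ → T ∣ Γ ⊢ ψ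
⊢-byCases φ d e = raa (⇒E (hyp (here refl)) (⇒E (weaken-⊢ there (⇒I e))
  (⇒I (⇒E (hyp (there (here refl))) (⇒E (weaken-⊢ (there ∘ there) (⇒I d)) (hyp (here refl)))))))

∧E₁ : ∀ {T n Γ} {φ ψ : Formula n} → T ∣ Γ ⊢ φ ∧̇ ψ → T ∣ Γ ⊢ φ
∧E₁ d = raa (⇒E (weaken-⊢ there d) (⇒I (⊥E (⇒E (hyp (there (here refl))) (hyp (here refl))))))

∧E₂ : ∀ {T n Γ} {φ ψ : Formula n} → T ∣ Γ ⊢ φ ∧̇ ψ → T ∣ Γ ⊢ ψ
∧E₂ d = raa (⇒E (weaken-⊢ there d) (⇒I (hyp (there (here refl)))))

∃I : ∀ {T n Γ} {φ : Formula (suc n)} t → T ∣ Γ ⊢ φ [ t ] → T ∣ Γ ⊢ ∃̇ φ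
∃I t d = ⇒I (⇒E (∀E (hyp (here refl)) t) (weaken-⊢ there d))

∃E : ∀ {T n Γ} {φ : Formula (suc n)} {ψ} →
  T ∣ Γ ⊢ ∃̇ φ → T ∣ φ ∷ map weaken Γ ⊢ weaken ψ → T ∣ Γ ⊢ ψ
∃E d e = raa (⇒E (weaken-⊢ there d)
  (∀I (⇒I (⇒E (hyp (there (here refl))) (⇒E (weaken-⊢ (there ∘ there) (⇒I e)) (hyp (here refl)))))))

≐-cong : ∀ {T n Γ} {s t : Term n} (C : Term (suc n)) → T ∣ Γ ⊢ s ≐ t →
  T ∣ Γ ⊢ substᵗ (single s) C ≐ substᵗ (single t) C
≐-cong {T} {Γ = Γ} {s} {t} C d = transport (λ u → T ∣ Γ ⊢ u ≐ substᵗ (single t) C) (substᵗ-single-suc t _)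
  (≐E (renameᵗ suc (substᵗ (single s) C) ≐ C) d
    (transport (λ u → T ∣ Γ ⊢ u ≐ substᵗ (single s) C) (sym (substᵗ-single-suc s (substᵗ (single s) C)))
        (≐I _)))

≐-sym : ∀ {T n Γ} {s t : Term n} → T ∣ Γ ⊢ s ≐ t → T ∣ Γ ⊢ t ≐ s
≐-sym {s = s} {t} d = transport (λ u → _ ∣ _ ⊢ t ≐ u) (substᵗ-single-suc t s)
  (≐E (var zero ≐ renameᵗ suc s) d
    (transport (λ u → _ ∣ _ ⊢ s ≐ u) (sym (substᵗ-single-suc s s)) (≐I s)))

≐-trans : ∀ {T n Γ} {s t u : Term n} → T ∣ Γ ⊢ s ≐ t → T ∣ Γ ⊢ t ≐ u → T ∣ Γ ⊢ s ≐ u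
≐-trans {s = s} {t} {u} d e = transport (λ v → _ ∣ _ ⊢ v ≐ u) (substᵗ-single-suc u s)
  (≐E (renameᵗ suc s ≐ var zero) e
    (transport (λ v → _ ∣ _ ⊢ v ≐ t) (sym (substᵗ-single-suc t s)) d))

infix 11 _⟨_⟩

-- φ ⟨ t ⟩ may live in any number of variables, unlike φ [ t ].
_⟨_⟩ : ∀ {n} → Formula 1 → Term n → Formula n
φ ⟨ t ⟩ = subst (λ _ → t) φ

subst-⟨⟩ : ∀ {m n} (θ : Fin m → Term n) φ t → subst θ (φ ⟨ t ⟩) ≡ φ ⟨ substᵗ θ t ⟩
subst-⟨⟩ θ φ t = subst-∘ θ _ φ

rename-⟨⟩ : ∀ {m n} (ρ : Fin m → Fin n) φ t → rename ρ (φ ⟨ t ⟩) ≡ φ ⟨ renameᵗ ρ t ⟩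
rename-⟨⟩ ρ φ t = rename-subst ρ _ φ

⟨var⟩ : ∀ φ → φ ⟨ var zero ⟩ ≡ φ
⟨var⟩ φ = trans (subst-cong (λ where zero → refl) φ) (subst-var φ)

≐-⟨⟩ : ∀ {T n Γ} {s t : Term n} φ → T ∣ Γ ⊢ s ≐ t → T ∣ Γ ⊢ φ ⟨ s ⟩ → T ∣ Γ ⊢ φ ⟨ t ⟩
≐-⟨⟩ {s = s} {t} φ d e = transport (_ ∣ _ ⊢_) (subst-⟨⟩ (single t) φ (var zero))
  (≐E (φ ⟨ var zero ⟩) d (transport (_ ∣ _ ⊢_) (sym (subst-⟨⟩ (single s) φ (var zero))) e))

-- Undoes `∀I`: a universal theorem becomes usable at the current bound variable, with no
-- substitution left over.
∀⁻ : ∀ {T n Γ} {φ : Formula (suc n)} → T ∣ Γ ⊢ ∀̇ φ → T ∣ map weaken Γ ⊢ φ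
∀⁻ {φ = φ} d = transport (_ ∣ _ ⊢_)
  (trans (subst-rename _ _ φ) (trans (subst-cong (λ { zero → refl ; (suc i) → refl }) φ) (subst-var φ)))
  (∀E (rename-⊢ (∈-map⁺ weaken) d) (var zero))

-- Numerals, and arithmetic in extensions of Q.

num : ∀ {n} → ℕ → Term n
num zero    = zeroᵗ
num (suc k) = sucᵗ (num k)

substᵗ-num : ∀ {m n} (θ : Fin m → Term n) k → substᵗ θ (num k) ≡ num k
substᵗ-num θ zero    = refl
substᵗ-num θ (suc k) = cong sucᵗ (substᵗ-num θ k)

renameᵗ-num : ∀ {m n} (ρ : Fin m → Fin n) k → renameᵗ ρ (num k) ≡ num k
renameᵗ-num ρ zero    = refl
renameᵗ-num ρ (suc k) = cong sucᵗ (renameᵗ-num ρ k)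

≡⇒≐-num : ∀ {T n} {Γ : List (Formula n)} {j k} → j ≡ k → T ∣ Γ ⊢ num j ≐ num k
≡⇒≐-num refl = ≐I _

module Arithmetic {T : Theory} (Q⊆T : T Extends Q) where

  private
    q : ∀ {σ n} {Γ : List (Formula n)} → Q σ → T ∣ Γ ⊢ embed σ
    q a = embed-⊢ (Q⊆T _ a)

  module _ {n} {Γ : List (Formula n)} where

    ⊢-suc≢0 : ∀ {t} → T ∣ Γ ⊢ sucᵗ t ≐ zeroᵗ → T ∣ Γ ⊢ ⊥̇
    ⊢-suc≢0 {t} d = ⇒E (∀E (q suc≢0) t) d

    ⊢-suc-inj : ∀ {s t} → T ∣ Γ ⊢ sucᵗ s ≐ sucᵗ t → T ∣ Γ ⊢ s ≐ t
    ⊢-suc-inj {s} {t} d = ⇒E (transport (λ u → T ∣ Γ ⊢ sucᵗ u ≐ sucᵗ t ⇒ u ≐ t)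
      (substᵗ-single-suc t s) (∀E (∀E (q suc-inj) s) t)) d

    ⊢-suc-cong : ∀ {s t} → T ∣ Γ ⊢ s ≐ t → T ∣ Γ ⊢ sucᵗ s ≐ sucᵗ t
    ⊢-suc-cong = ≐-cong (sucᵗ (var zero))

    ⊢-+-zero : ∀ t → T ∣ Γ ⊢ t +ᵗ zeroᵗ ≐ t
    ⊢-+-zero t = ∀E (q +-zero) t

    ⊢-+-suc : ∀ s t → T ∣ Γ ⊢ s +ᵗ sucᵗ t ≐ sucᵗ (s +ᵗ t)
    ⊢-+-suc s t = transport (λ u → T ∣ Γ ⊢ u +ᵗ sucᵗ t ≐ sucᵗ (u +ᵗ t))
      (substᵗ-single-suc t s) (∀E (∀E (q +-suc) s) t)

    ⊢-·-zero : ∀ t → T ∣ Γ ⊢ t ·ᵗ zeroᵗ ≐ zeroᵗ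
    ⊢-·-zero t = ∀E (q ·-zero) t

    ⊢-·-suc : ∀ s t → T ∣ Γ ⊢ s ·ᵗ sucᵗ t ≐ s ·ᵗ t +ᵗ s
    ⊢-·-suc s t = transport (λ u → T ∣ Γ ⊢ u ·ᵗ sucᵗ t ≐ u ·ᵗ t +ᵗ u)
      (substᵗ-single-suc t s) (∀E (∀E (q ·-suc) s) t)

    ⊢-+-cong : ∀ {s s′ t t′} → T ∣ Γ ⊢ s ≐ s′ → T ∣ Γ ⊢ t ≐ t′ → T ∣ Γ ⊢ s +ᵗ t ≐ s′ +ᵗ t′
    ⊢-+-cong {s} {s′} {t} {t′} d e = ≐-trans
      (transport (λ u → T ∣ Γ ⊢ s +ᵗ u ≐ s′ +ᵗ t) (substᵗ-single-suc s t)
        (transport (λ u → T ∣ Γ ⊢ _ ≐ s′ +ᵗ u) (substᵗ-single-suc s′ t) (≐-cong (var zero +ᵗ renameᵗ suc t) d)))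
      (transport (λ u → T ∣ Γ ⊢ u +ᵗ t ≐ s′ +ᵗ t′) (substᵗ-single-suc t s′)
        (transport (λ u → T ∣ Γ ⊢ _ ≐ u +ᵗ t′) (substᵗ-single-suc t′ s′)
            (≐-cong (renameᵗ suc s′ +ᵗ var zero) e)))

    ⊢-·-cong : ∀ {s s′ t t′} → T ∣ Γ ⊢ s ≐ s′ → T ∣ Γ ⊢ t ≐ t′ → T ∣ Γ ⊢ s ·ᵗ t ≐ s′ ·ᵗ t′
    ⊢-·-cong {s} {s′} {t} {t′} d e = ≐-trans
      (transport (λ u → T ∣ Γ ⊢ s ·ᵗ u ≐ s′ ·ᵗ t) (substᵗ-single-suc s t)
        (transport (λ u → T ∣ Γ ⊢ _ ≐ s′ ·ᵗ u) (substᵗ-single-suc s′ t) (≐-cong (var zero ·ᵗ renameᵗ suc t) d)))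
      (transport (λ u → T ∣ Γ ⊢ u ·ᵗ t ≐ s′ ·ᵗ t′) (substᵗ-single-suc t s′)
        (transport (λ u → T ∣ Γ ⊢ _ ≐ u ·ᵗ t′) (substᵗ-single-suc t′ s′)
            (≐-cong (renameᵗ suc s′ ·ᵗ var zero) e)))

    private
      ≼-def : ∀ s t → T ∣ Γ ⊢ s ≼ t ⇔̇ ∃̇ (var zero +ᵗ renameᵗ suc s ≐ renameᵗ suc t)
      ≼-def s t = transport (λ u → T ∣ Γ ⊢ s ≼ t ⇔̇ ∃̇ (var zero +ᵗ u ≐ renameᵗ suc t)) eq
        (transport (λ u → T ∣ Γ ⊢ u ≼ t ⇔̇ ∃̇ (var zero +ᵗ substᵗ (exts (single t))
            (renameᵗ suc (renameᵗ suc s)) ≐ renameᵗ suc t)) (substᵗ-single-suc t s)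
          (∀E (∀E (q ≤-def) s) t))
        where
        eq : substᵗ (exts (single t)) (renameᵗ suc (renameᵗ suc s)) ≡ renameᵗ suc s
        eq = trans (substᵗ-renameᵗ _ suc (renameᵗ suc s))
            (trans (sym (renameᵗ-substᵗ suc (single t) (renameᵗ suc s)))
          (cong (renameᵗ suc) (substᵗ-single-suc t s)))

    ≼I : ∀ {s t} u → T ∣ Γ ⊢ u +ᵗ s ≐ t → T ∣ Γ ⊢ s ≼ t
    ≼I {s} {t} u d = ⇒E (∧E₂ (≼-def s t)) (∃I u
      (transport (λ v → T ∣ Γ ⊢ u +ᵗ v ≐ _) (sym (substᵗ-single-suc u s))
        (transport (λ v → T ∣ Γ ⊢ u +ᵗ s ≐ v) (sym (substᵗ-single-suc u t)) d)))

    ≼E : ∀ {s t ψ} → T ∣ Γ ⊢ s ≼ t →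
      T ∣ (var zero +ᵗ renameᵗ suc s ≐ renameᵗ suc t) ∷ map weaken Γ ⊢ weaken ψ → T ∣ Γ ⊢ ψ
    ≼E {s} {t} d = ∃E (⇒E (∧E₁ (≼-def s t)) d)

    0≼ : ∀ {t} → T ∣ Γ ⊢ zeroᵗ ≼ t
    0≼ = ≼I _ (⊢-+-zero _)

    -- Q has no induction. This split into zero and successor, repeated down a numeral by an
    -- induction in the metatheory, takes its place.
    ⊢-pred : ∀ t {φ} → T ∣ t ≐ zeroᵗ ∷ Γ ⊢ φ →
      T ∣ renameᵗ suc t ≐ sucᵗ (var zero) ∷ map weaken Γ ⊢ weaken φ → T ∣ Γ ⊢ φ
    ⊢-pred t d e = ⊢-byCases (t ≐ zeroᵗ) d (∃E (⇒E (∀E (embed-⊢ (Q⊆T _ pred)) t) (hyp (here refl)))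
      (⇒E (weaken-⊢ (there ∘ there) (⇒I e)) (hyp (here refl))))

  module _ {n} {Γ : List (Formula n)} where

    -- The equation behind `s ≼ t` has `s` as its right summand, the one on which addition recurses.
    -- So `+-suc` extracts the successor here and in the next two lemmas, without commutativity of
    -- addition, which Q does not prove.
    ¬suc≼0 : ∀ {s} → T ∣ Γ ⊢ sucᵗ s ≼ zeroᵗ → T ∣ Γ ⊢ ⊥̇
    ¬suc≼0 d = ≼E d (⊢-suc≢0 (≐-trans (≐-sym (⊢-+-suc _ _)) (hyp (here refl))))

    suc≼suc⁺ : ∀ {s t} → T ∣ Γ ⊢ s ≼ t → T ∣ Γ ⊢ sucᵗ s ≼ sucᵗ t
    suc≼suc⁺ d = ≼E d (≼I (var zero) (≐-trans (⊢-+-suc _ _) (⊢-suc-cong (hyp (here refl)))))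

    suc≼suc⁻ : ∀ {s t} → T ∣ Γ ⊢ sucᵗ s ≼ sucᵗ t → T ∣ Γ ⊢ s ≼ t
    suc≼suc⁻ d = ≼E d (≼I (var zero) (⊢-suc-inj (≐-trans (≐-sym (⊢-+-suc _ _)) (hyp (here refl)))))

    ≤⇒≼ : ∀ {j k} → j ≤ k → T ∣ Γ ⊢ num j ≼ num k
    ≤⇒≼ z≤n       = 0≼
    ≤⇒≼ (s≤s j≤k) = suc≼suc⁺ (≤⇒≼ j≤k)

    ≰⇒⋠ : ∀ j k → ¬ (j ≤ k) → T ∣ Γ ⊢ num j ≼ num k → T ∣ Γ ⊢ ⊥̇
    ≰⇒⋠ zero    k       j≰k d = ⊥-elim (j≰k z≤n)
    ≰⇒⋠ (suc j) zero    j≰k d = ¬suc≼0 d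
    ≰⇒⋠ (suc j) (suc k) j≰k d = ≰⇒⋠ j k (j≰k ∘ s≤s) (suc≼suc⁻ d)

    ≢⇒≭ : ∀ j k → j ≢ k → T ∣ Γ ⊢ num j ≐ num k → T ∣ Γ ⊢ ⊥̇
    ≢⇒≭ zero    zero    j≢k d = ⊥-elim (j≢k refl)
    ≢⇒≭ zero    (suc k) j≢k d = ⊢-suc≢0 (≐-sym d)
    ≢⇒≭ (suc j) zero    j≢k d = ⊢-suc≢0 d
    ≢⇒≭ (suc j) (suc k) j≢k d = ≢⇒≭ j k (j≢k ∘ cong suc) (⊢-suc-inj d)

    num-+ : ∀ j k → T ∣ Γ ⊢ num j +ᵗ num k ≐ num (j + k)
    num-+ j zero    = ≐-trans (⊢-+-zero _) (≡⇒≐-num (sym (+-identityʳ j)))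
    num-+ j (suc k) = ≐-trans (⊢-+-suc _ _) (≐-trans (⊢-suc-cong (num-+ j k)) (≡⇒≐-num (sym (ℕ-+-suc j k))))

    num-· : ∀ j k → T ∣ Γ ⊢ num j ·ᵗ num k ≐ num (j * k)
    num-· j zero    = ≐-trans (⊢-·-zero _) (≡⇒≐-num (sym (*-zeroʳ j)))
    num-· j (suc k) = ≐-trans (⊢-·-suc _ _) (≐-trans (⊢-+-cong (num-· j k) (≐I _))
      (≐-trans (num-+ (j * k) j) (≡⇒≐-num (trans (+-comm (j * k) j) (sym (*-suc j k))))))

  private
    ≼-num⁻ : ∀ {m n Γ s} (θ : Fin m → Term n) w → T ∣ Γ ⊢ s ≼ substᵗ θ (num w) → T ∣ Γ ⊢ s ≼ num w
    ≼-num⁻ {Γ = Γ} {s} θ w = transport (λ t → T ∣ Γ ⊢ s ≼ t) (substᵗ-num θ w)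

    ≼-num⁺ : ∀ {m n Γ s} (θ : Fin m → Term n) w → T ∣ Γ ⊢ s ≼ num w → T ∣ Γ ⊢ s ≼ substᵗ θ (num w)
    ≼-num⁺ {Γ = Γ} {s} θ w = transport (λ t → T ∣ Γ ⊢ s ≼ t) (sym (substᵗ-num θ w))

    num-≼⁺ : ∀ {m n Γ s} (θ : Fin m → Term n) w → T ∣ Γ ⊢ num w ≼ s → T ∣ Γ ⊢ substᵗ θ (num w) ≼ s
    num-≼⁺ {Γ = Γ} {s} θ w = transport (λ t → T ∣ Γ ⊢ t ≼ s) (sym (substᵗ-num θ w))

  ∀-cases : ∀ φ → T ⊢ φ ⟨ zeroᵗ ⟩ → T ⊢ ∀̇ φ ⟨ sucᵗ (var zero) ⟩ → T ⊢ ∀̇ φ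
  ∀-cases φ d e = ∀I (transport (T ∣ [] ⊢_) (⟨var⟩ φ) (⊢-pred (var zero)
    (≐-⟨⟩ φ (≐-sym (hyp (here refl)))
      (transport (T ∣ _ ⊢_) (rename-⟨⟩ _ φ zeroᵗ) (embed-⊢ d)))
    (transport (T ∣ _ ⊢_) (sym (rename-⟨⟩ suc φ (var zero)))
      (≐-⟨⟩ φ (≐-sym (hyp (here refl)))
        (transport (T ∣ _ ⊢_)
          (trans (cong (_[ var zero ]) (rename-⟨⟩ _ φ _)) (subst-⟨⟩ _ φ _))
          (∀E (embed-⊢ e) (var zero)))))))

  -- Induction on w in the metatheory. After the split of the variable into 0 or a successor s(y),
  -- the bound s(y) ≼ s(w) becomes y ≼ w, and the induction hypothesis applies to the shifted
  -- formula φ(s(y)).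
  ∀≼-intro : ∀ w φ → (∀ k → k ≤ w → T ⊢ φ ⟨ num k ⟩) → T ⊢ ∀̇ (var zero ≼ num w ⇒ φ)
  ∀≼-intro w φ h = ∀-cases _ (⇒I (weaken-⊢ there (h 0 z≤n))) (∀I (⇒I (suc-case w h)))
    where
    suc-case : ∀ w → (∀ k → k ≤ w → T ⊢ φ ⟨ num k ⟩) →
      T ∣ sucᵗ (var zero) ≼ substᵗ (λ _ → sucᵗ (var zero)) (num w) ∷ [] ⊢ φ ⟨ sucᵗ (var zero) ⟩
    suc-case zero    h = ⊥E (¬suc≼0 (hyp (here refl)))
    suc-case (suc w) h = ⇒E
      (weaken-⊢ there (∀⁻ (∀≼-intro w (φ ⟨ sucᵗ (var zero) ⟩)
        λ k k≤w → transport (T ⊢_) (sym (subst-⟨⟩ _ φ _)) (h (suc k) (s≤s k≤w)))))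
      (≼-num⁻ (λ _ → sucᵗ (var zero)) w (suc≼suc⁻ (hyp (here refl))))

  -- The same induction as in `∀≼-intro`. Q does not prove its order linear, but comparability with
  -- a numeral is enough for Rosser's argument.
  ≼-total : ∀ w → T ⊢ ∀̇ (¬̇ (var zero ≼ num w) ⇒ num w ≼ var zero)
  ≼-total zero    = ∀I (⇒I 0≼)
  ≼-total (suc w) = ∀-cases _
    (⇒I (⊥E (⇒E (hyp (here refl)) 0≼)))
    (∀I (⇒I (suc≼suc⁺ (num-≼⁺ (λ _ → sucᵗ (var zero)) w
      (⇒E (weaken-⊢ there (∀⁻ (≼-total w)))
        (⇒I (⇒E (hyp (there (here refl))) (suc≼suc⁺ (≼-num⁺ (λ _ → sucᵗ (var zero)) w (hyp (here refl)))))))))))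

-- Truth with all quantifiers below one bound.

-- Since `∃̇` abbreviates `¬̇ ∀̇ ¬̇`, bounding the universal quantifiers bounds the existential ones
-- too.
bounded : ∀ {n} → Term n → Formula n → Formula n
bounded b ⊥̇       = ⊥̇
bounded b (s ≐ t) = s ≐ t
bounded b (s ≼ t) = s ≼ t
bounded b (φ ⇒ ψ) = bounded b φ ⇒ bounded b ψ
bounded b (∀̇ φ)   = ∀̇ (var zero ≼ renameᵗ suc b ⇒ bounded (renameᵗ suc b) φ)

substᵗ-exts-suc : ∀ {m n} (θ : Fin m → Term n) t → substᵗ (exts θ) (renameᵗ suc t) ≡ renameᵗ suc (substᵗ θ t)
substᵗ-exts-suc θ t = trans (substᵗ-renameᵗ (exts θ) suc t) (sym (renameᵗ-substᵗ suc θ t))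

subst-bounded : ∀ {m n} (θ : Fin m → Term n) b φ →
  subst θ (bounded b φ) ≡ bounded (substᵗ θ b) (subst θ φ)
subst-bounded θ b ⊥̇       = refl
subst-bounded θ b (s ≐ t) = refl
subst-bounded θ b (s ≼ t) = refl
subst-bounded θ b (φ ⇒ ψ) = cong₂ _⇒_ (subst-bounded θ b φ) (subst-bounded θ b ψ)
subst-bounded θ b (∀̇ φ)   = cong₂ (λ c ψ → ∀̇ (var zero ≼ c ⇒ ψ)) (substᵗ-exts-suc θ b)
  (trans (subst-bounded (exts θ) (renameᵗ suc b) φ)
    (cong (λ c → bounded c (subst (exts θ) φ)) (substᵗ-exts-suc θ b)))

⟦_⟧ᵗ : ∀ {n} → Term n → Vec ℕ n → ℕ
⟦ var i ⟧ᵗ  ρ = lookup ρ i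
⟦ zeroᵗ ⟧ᵗ  ρ = 0
⟦ sucᵗ t ⟧ᵗ ρ = suc (⟦ t ⟧ᵗ ρ)
⟦ s +ᵗ t ⟧ᵗ ρ = ⟦ s ⟧ᵗ ρ + ⟦ t ⟧ᵗ ρ
⟦ s ·ᵗ t ⟧ᵗ ρ = ⟦ s ⟧ᵗ ρ * ⟦ t ⟧ᵗ ρ

Sat : ∀ {n} → ℕ → Vec ℕ n → Formula n → Set
Sat b ρ ⊥̇       = ⊥
Sat b ρ (s ≐ t) = ⟦ s ⟧ᵗ ρ ≡ ⟦ t ⟧ᵗ ρ
Sat b ρ (s ≼ t) = ⟦ s ⟧ᵗ ρ ≤ ⟦ t ⟧ᵗ ρ
Sat b ρ (φ ⇒ ψ) = Sat b ρ φ → Sat b ρ ψ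
Sat b ρ (∀̇ φ)   = ∀ k → k ≤ b → Sat b (k ∷ ρ) φ

all-or-counterexample : ∀ {P : ℕ → Set} → (∀ k → Dec (P k)) → ∀ b →
  (∀ k → k ≤ b → P k) ⊎ (∃ λ k → k ≤ b × ¬ P k)
all-or-counterexample P? b with anyUpTo? (¬? ∘ P?) (suc b)
... | yes (k , s≤s k≤b , ¬p) = inj₂ (k , k≤b , ¬p)
... | no ¬any = inj₁ λ k k≤b → decidable-stable (P? k) λ ¬p → ¬any (k , s≤s k≤b , ¬p)

-- Removes the double negations that the classical encodings of conjunction, disjunction and `∃̇`
-- leave behind when a true formula is read back in the metatheory.
Sat? : ∀ {n} b (ρ : Vec ℕ n) φ → Dec (Sat b ρ φ)
Sat? b ρ ⊥̇       = no id
Sat? b ρ (s ≐ t) = ⟦ s ⟧ᵗ ρ ≟ ⟦ t ⟧ᵗ ρ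
Sat? b ρ (s ≼ t) = ⟦ s ⟧ᵗ ρ ≤? ⟦ t ⟧ᵗ ρ
Sat? b ρ (φ ⇒ ψ) = Sat? b ρ φ →-dec Sat? b ρ ψ
Sat? b ρ (∀̇ φ) with all-or-counterexample (λ k → Sat? b (k ∷ ρ) φ) b
... | inj₁ all              = yes all
... | inj₂ (k , k≤b , ¬sat) = no λ all → ¬sat (all k k≤b)

numerals : ∀ {m n} → Vec ℕ m → Fin m → Term n
numerals ρ i = num (lookup ρ i)

substᵗ-numerals : ∀ {n} k (ρ : Vec ℕ n) i → substᵗ {n = 0} (λ _ → num k)
    (exts (numerals {n = 0} ρ) i) ≡ numerals {n = 0} (k ∷ ρ) i
substᵗ-numerals k ρ zero    = refl
substᵗ-numerals k ρ (suc i) = trans (cong (substᵗ (λ _ → num k)) (renameᵗ-num suc (lookup ρ i)))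
    (substᵗ-num _ (lookup ρ i))

⟨⟩≡[] : ∀ (φ : Formula 1) (t : Term 0) → φ ⟨ t ⟩ ≡ φ [ t ]
⟨⟩≡[] φ t = subst-cong (λ where zero → refl) φ

module BoundedTruth {T : Theory} (Q⊆T : T Extends Q) where
  open Arithmetic Q⊆T

  private
    body-⟨⟩ : ∀ {n} b k (ρ : Vec ℕ n) φ →
      bounded (num b) (subst (exts (numerals ρ)) φ) ⟨ num k ⟩ ≡ bounded (num {0} b) (subst (numerals (k ∷ ρ)) φ)
    body-⟨⟩ b k ρ φ = trans (subst-bounded _ (num b) _) (cong₂ bounded (substᵗ-num _ b)
      (trans (subst-∘ _ _ φ) (subst-cong (substᵗ-numerals k ρ) φ)))

    ∀-bounded : ∀ {n} b (ρ : Vec ℕ n) φ →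
      bounded (num {0} b) (subst (numerals ρ) (∀̇ φ)) ≡
      ∀̇ (var zero ≼ num b ⇒ bounded (num b) (subst (exts (numerals ρ)) φ))
    ∀-bounded b ρ φ = cong (λ c → ∀̇ (var zero ≼ c ⇒ bounded c (subst (exts (numerals ρ)) φ)))
        (renameᵗ-num suc b)

    ⟦⟧ᵗ-⊢ : ∀ {n} (t : Term n) ρ → T ∣ [] {A = Formula 0} ⊢ substᵗ (numerals ρ) t ≐ num (⟦ t ⟧ᵗ ρ)
    ⟦⟧ᵗ-⊢ (var i)  ρ = ≐I _
    ⟦⟧ᵗ-⊢ zeroᵗ    ρ = ≐I _
    ⟦⟧ᵗ-⊢ (sucᵗ t) ρ = ⊢-suc-cong (⟦⟧ᵗ-⊢ t ρ)
    ⟦⟧ᵗ-⊢ (s +ᵗ t) ρ = ≐-trans (⊢-+-cong (⟦⟧ᵗ-⊢ s ρ) (⟦⟧ᵗ-⊢ t ρ)) (num-+ (⟦ s ⟧ᵗ ρ) _)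
    ⟦⟧ᵗ-⊢ (s ·ᵗ t) ρ = ≐-trans (⊢-·-cong (⟦⟧ᵗ-⊢ s ρ) (⟦⟧ᵗ-⊢ t ρ)) (num-· (⟦ s ⟧ᵗ ρ) _)

    ≼-resp : ∀ {Γ : List (Formula 0)} {s s′ t t′} → T ∣ Γ ⊢ s ≐ s′ → T ∣ Γ ⊢ t ≐ t′ → T ∣ Γ ⊢ s ≼ t →
        T ∣ Γ ⊢ s′ ≼ t′
    ≼-resp {Γ} {s} {s′} {t} {t′} d e f =
      transport (λ u → T ∣ Γ ⊢ u ≼ t′) (substᵗ-single-suc t′ s′) (≐E (renameᵗ suc s′ ≼ var zero) e
        (transport (λ u → T ∣ Γ ⊢ u ≼ t) (sym (substᵗ-single-suc t s′))
          (transport (λ u → T ∣ Γ ⊢ s′ ≼ u) (substᵗ-single-suc s′ t) (≐E (var zero ≼ renameᵗ suc t) d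
            (transport (λ u → T ∣ Γ ⊢ s ≼ u) (sym (substᵗ-single-suc s t)) f)))))

  -- The two directions need each other, as an implication uses the negative one for its premise. A
  -- true bounded quantifier follows from its finitely many instances by `∀≼-intro`; a false one is
  -- refuted at a counterexample k ≤ b.
  Sat⇒⊢  : ∀ {n} b (ρ : Vec ℕ n) φ → Sat b ρ φ → T ⊢ bounded (num b) (subst (numerals ρ) φ)
  ¬Sat⇒⊢ : ∀ {n} b (ρ : Vec ℕ n) φ → ¬ Sat b ρ φ → T ⊢ ¬̇ bounded (num b) (subst (numerals ρ) φ)

  Sat⇒⊢ b ρ (s ≐ t) eq = ≐-trans (⟦⟧ᵗ-⊢ s ρ) (≐-trans (≡⇒≐-num eq) (≐-sym (⟦⟧ᵗ-⊢ t ρ)))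
  Sat⇒⊢ b ρ (s ≼ t) le = ≼-resp (≐-sym (⟦⟧ᵗ-⊢ s ρ)) (≐-sym (⟦⟧ᵗ-⊢ t ρ)) (≤⇒≼ le)
  Sat⇒⊢ b ρ (φ ⇒ ψ) f with Sat? b ρ φ
  ... | yes p = ⇒I (weaken-⊢ there (Sat⇒⊢ b ρ ψ (f p)))
  ... | no ¬p = ⇒I (⊥E (⇒E (weaken-⊢ there (¬Sat⇒⊢ b ρ φ ¬p)) (hyp (here refl))))
  Sat⇒⊢ b ρ (∀̇ φ) f = transport (T ⊢_) (sym (∀-bounded b ρ φ))
    (∀≼-intro b _ λ k k≤b → transport (T ⊢_) (sym (body-⟨⟩ b k ρ φ)) (Sat⇒⊢ b (k ∷ ρ) φ (f k k≤b)))

  ¬Sat⇒⊢ b ρ ⊥̇ _ = ⇒I (hyp (here refl))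
  ¬Sat⇒⊢ b ρ (s ≐ t) ne = ⇒I (≢⇒≭ _ _ ne (≐-trans (≐-sym (weaken-⊢ there (⟦⟧ᵗ-⊢ s ρ)))
    (≐-trans (hyp (here refl)) (weaken-⊢ there (⟦⟧ᵗ-⊢ t ρ)))))
  ¬Sat⇒⊢ b ρ (s ≼ t) nle = ⇒I (≰⇒⋠ _ _ nle (≼-resp (weaken-⊢ there (⟦⟧ᵗ-⊢ s ρ)) (weaken-⊢ there (⟦⟧ᵗ-⊢ t ρ))
      (hyp (here refl))))
  ¬Sat⇒⊢ b ρ (φ ⇒ ψ) ¬f =
    ⇒I (⇒E (weaken-⊢ there (¬Sat⇒⊢ b ρ ψ λ q → ¬f λ _ → q))
      (⇒E (hyp (here refl)) (weaken-⊢ there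
        (Sat⇒⊢ b ρ φ (decidable-stable (Sat? b ρ φ) λ ¬p → ¬f λ p → ⊥-elim (¬p p))))))
  ¬Sat⇒⊢ b ρ (∀̇ φ) ¬all with all-or-counterexample (λ k → Sat? b (k ∷ ρ) φ) b
  ... | inj₁ all            = ⊥-elim (¬all all)
  ... | inj₂ (k , k≤b , ¬p) = transport (λ σ → T ⊢ ¬̇ σ) (sym (∀-bounded b ρ φ))
    (⇒I (⇒E (weaken-⊢ there (¬Sat⇒⊢ b (k ∷ ρ) φ ¬p))
      (transport (T ∣ _ ⊢_) (trans (sym (⟨⟩≡[] χ (num k))) (body-⟨⟩ b k ρ φ))
        (⇒E (∀E (hyp (here refl)) (num k)) (transport (λ t → T ∣ _ ⊢ num k ≼ t) (sym (substᵗ-num _ b))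
            (≤⇒≼ k≤b))))))
    where χ = bounded (num b) (subst (exts (numerals ρ)) φ)

-- Rosser's sentence, for arbitrary properties α and β.

rosser : Formula 1 → Formula 1 → Sentence
rosser α β = ∀̇ (α ⇒ ¬̇ ∀̇ (var zero ≼ var (suc zero) ⇒ ¬̇ β ⟨ var zero ⟩))

module Rosser {T : Theory} (Q⊆T : T Extends Q) (α β : Formula 1) where
  open Arithmetic Q⊆T

  -- Only the instance at w is used: β is refuted at each numeral up to w, so `∀≼-intro` contradicts
  -- the existential conclusion.
  rosser-refutable : ∀ w → T ⊢ α ⟨ num w ⟩ → (∀ v → T ⊢ ¬̇ β ⟨ num v ⟩) → T ⊢ rosser α β → T ⊢ ⊥̇
  rosser-refutable w d ¬β e = ⇒E
    (⇒E (∀E e (num w)) (transport (T ⊢_) (⟨⟩≡[] α (num w)) d))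
    (transport (λ χ → T ⊢ ∀̇ χ) eq (∀≼-intro w (¬̇ β) λ v _ → ¬β v))
    where
    eq : (var zero ≼ num w ⇒ ¬̇ β) ≡ subst (exts (single (num w)))
        (var zero ≼ var (suc zero) ⇒ ¬̇ β ⟨ var zero ⟩)
    eq = cong₂ (λ t χ → var zero ≼ t ⇒ ¬̇ χ) (sym (renameᵗ-num suc w))
      (trans (sym (⟨var⟩ β)) (sym (subst-⟨⟩ _ β (var zero))))

  -- Compare x with v inside T. If x ≼ v, then x falls under the finitely many numerals at which α
  -- is refuted; otherwise v ≼ x by `≼-total`, and v is the required witness of β.
  rosser-provable : ∀ v → T ⊢ β ⟨ num v ⟩ → (∀ w → T ⊢ ¬̇ α ⟨ num w ⟩) → T ⊢ rosser α β
  rosser-provable v d ¬α = ∀I (⇒I (⇒I (⊢-byCases (var zero ≼ num v)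
    (⇒E (⇒E (weaken-⊢ (λ ()) (∀⁻ (∀≼-intro v (¬̇ α) λ w _ → ¬α w))) (hyp (here refl)))
      (hyp (there (there (here refl)))))
    (⇒E (instance-⟨⟩ (⇒E (∀E (hyp (there (here refl))) (num v))
            (⇒E (weaken-⊢ (λ ()) (∀⁻ (≼-total v))) (hyp (here refl)))))
      (embed-β _)))))
    where
    embed-β : ∀ (Γ : List (Formula 1)) → T ∣ Γ ⊢ β ⟨ num v ⟩
    embed-β Γ = transport (T ∣ Γ ⊢_) (trans (rename-⟨⟩ _ β (num v)) (cong (β ⟨_⟩) (renameᵗ-num _ v)))
        (embed-⊢ d)

    instance-⟨⟩ : ∀ {Γ : List (Formula 1)} → T ∣ Γ ⊢ ¬̇ subst (single (num v)) (β ⟨ var zero ⟩) →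
        T ∣ Γ ⊢ ¬̇ β ⟨ num v ⟩
    instance-⟨⟩ {Γ} = transport (λ χ → T ∣ Γ ⊢ ¬̇ χ) (subst-⟨⟩ _ β (var zero))

-- Closure properties of Σ₁ relations.

Eventually : (ℕ → Set) → Set
Eventually P = ∃ λ w₀ → ∀ w → w₀ ≤ w → P w

always : ∀ {P : ℕ → Set} → (∀ w → P w) → Eventually P
always h = 0 , λ w _ → h w

eventually-map : ∀ {P R : ℕ → Set} → (∀ {w} → P w → R w) → Eventually P → Eventually R
eventually-map f (w₀ , h) = w₀ , λ w le → f (h w le)

eventually-zip : ∀ {P R S : ℕ → Set} → (∀ {w} → P w → R w → S w) → Eventually P → Eventually R → Eventually S
eventually-zip f (u , g) (v , h) = u + v , λ w le → f (g w (m+n≤o⇒m≤o u le)) (h w (m+n≤o⇒n≤o u le))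

eventually-≥ : ∀ k → Eventually (k ≤_)
eventually-≥ k = k , λ _ le → le

eventually-all : ∀ {P : ℕ → ℕ → Set} b → (∀ k → k ≤ b → Eventually (P k)) →
    Eventually (λ w → ∀ k → k ≤ b → P k w)
eventually-all zero    h = eventually-map (λ { p .0 z≤n → p }) (h 0 z≤n)
eventually-all (suc b) h = eventually-zip (λ { p q zero _ → p ; p q (suc k) (s≤s le) → q k le })
  (h 0 z≤n) (eventually-all b λ k le → h (suc k) (s≤s le))

-- Truth below w is not monotone in w, hence completeness for all large w.
record Σ₁ {n} (R : Vec ℕ n → Set) : Set where
  field
    formula  : Formula n
    sound    : ∀ {w} ρ → Sat w ρ formula → R ρ
    complete : ∀ ρ → R ρ → Eventually (λ w → Sat w ρ formula)

open Σ₁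

Σ₁-map : ∀ {n} {R S : Vec ℕ n → Set} → (∀ ρ → R ρ → S ρ) → (∀ ρ → S ρ → R ρ) → Σ₁ R → Σ₁ S
Σ₁-map f g r .formula       = formula r
Σ₁-map f g r .sound ρ p     = f ρ (sound r ρ p)
Σ₁-map f g r .complete ρ p  = complete r ρ (g ρ p)

≡-Σ₁ : ∀ {n} (s t : Term n) → Σ₁ (λ ρ → ⟦ s ⟧ᵗ ρ ≡ ⟦ t ⟧ᵗ ρ)
≡-Σ₁ s t .formula      = s ≐ t
≡-Σ₁ s t .sound ρ p    = p
≡-Σ₁ s t .complete ρ p = always λ _ → p

≢-Σ₁ : ∀ {n} (s t : Term n) → Σ₁ (λ ρ → ⟦ s ⟧ᵗ ρ ≢ ⟦ t ⟧ᵗ ρ)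
≢-Σ₁ s t .formula      = ¬̇ (s ≐ t)
≢-Σ₁ s t .sound ρ p    = p
≢-Σ₁ s t .complete ρ p = always λ _ → p

≤-Σ₁ : ∀ {n} (s t : Term n) → Σ₁ (λ ρ → ⟦ s ⟧ᵗ ρ ≤ ⟦ t ⟧ᵗ ρ)
≤-Σ₁ s t .formula      = s ≼ t
≤-Σ₁ s t .sound ρ p    = p
≤-Σ₁ s t .complete ρ p = always λ _ → p

⊥-Σ₁ : ∀ {n} → Σ₁ {n} (λ _ → ⊥)
⊥-Σ₁ .formula = ⊥̇
⊥-Σ₁ .sound ρ p = p
⊥-Σ₁ .complete ρ ()

Sat-∧⁻ : ∀ {n w} {ρ : Vec ℕ n} φ ψ → Sat w ρ (φ ∧̇ ψ) → Sat w ρ φ × Sat w ρ ψ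
Sat-∧⁻ {w = w} {ρ} φ ψ h = decidable-stable (Sat? w ρ φ) (λ ¬p → h λ p _ → ¬p p)
                         , decidable-stable (Sat? w ρ ψ) (λ ¬q → h λ _ q → ¬q q)

infixr 5 _×-Σ₁_
infixr 4 _⊎-Σ₁_

_×-Σ₁_ : ∀ {n} {R S : Vec ℕ n → Set} → Σ₁ R → Σ₁ S → Σ₁ (λ ρ → R ρ × S ρ)
(r ×-Σ₁ s) .formula = formula r ∧̇ formula s
(r ×-Σ₁ s) .sound ρ h with Sat-∧⁻ (formula r) (formula s) h
... | p , q = sound r ρ p , sound s ρ q
(r ×-Σ₁ s) .complete ρ (p , q) = eventually-zip (λ p q h → h p q) (complete r ρ p) (complete s ρ q)

_⊎-Σ₁_ : ∀ {n} {R S : Vec ℕ n → Set} → Σ₁ R → Σ₁ S → Σ₁ (λ ρ → R ρ ⊎ S ρ)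
(r ⊎-Σ₁ s) .formula = ¬̇ formula r ⇒ formula s
(r ⊎-Σ₁ s) .sound {w} ρ h with Sat? w ρ (formula r)
... | yes p = inj₁ (sound r ρ p)
... | no ¬p = inj₂ (sound s ρ (h ¬p))
(r ⊎-Σ₁ s) .complete ρ (inj₁ p) = eventually-map (λ p ¬p → ⊥-elim (¬p p)) (complete r ρ p)
(r ⊎-Σ₁ s) .complete ρ (inj₂ q) = eventually-map (λ q _ → q) (complete s ρ q)

∃-Σ₁ : ∀ {n} {R : Vec ℕ (suc n) → Set} → Σ₁ R → Σ₁ (λ ρ → ∃ λ k → R (k ∷ ρ))
∃-Σ₁ r .formula = ∃̇ formula r
∃-Σ₁ r .sound {w} ρ h with all-or-counterexample (λ k → ¬? (Sat? w (k ∷ ρ) (formula r))) w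
... | inj₁ none            = ⊥-elim (h none)
... | inj₂ (k , _ , ¬¬sat) = k , sound r (k ∷ ρ) (decidable-stable (Sat? w (k ∷ ρ) (formula r)) ¬¬sat)
∃-Σ₁ r .complete ρ (k , p) = eventually-zip (λ k≤w p h → h k k≤w p) (eventually-≥ k) (complete r (k ∷ ρ) p)

⟦renameᵗ⟧ : ∀ {m n} (π : Fin m → Fin n) {ρ : Vec ℕ n} {ρ′ : Vec ℕ m} →
  (∀ i → lookup ρ (π i) ≡ lookup ρ′ i) → ∀ t → ⟦ renameᵗ π t ⟧ᵗ ρ ≡ ⟦ t ⟧ᵗ ρ′
⟦renameᵗ⟧ π eq (var i)  = eq i
⟦renameᵗ⟧ π eq zeroᵗ    = refl
⟦renameᵗ⟧ π eq (sucᵗ t) = cong suc (⟦renameᵗ⟧ π eq t)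
⟦renameᵗ⟧ π eq (s +ᵗ t) = cong₂ _+_ (⟦renameᵗ⟧ π eq s) (⟦renameᵗ⟧ π eq t)
⟦renameᵗ⟧ π eq (s ·ᵗ t) = cong₂ _*_ (⟦renameᵗ⟧ π eq s) (⟦renameᵗ⟧ π eq t)

⟦suc⟧ : ∀ {n} k (ρ : Vec ℕ n) t → ⟦ renameᵗ suc t ⟧ᵗ (k ∷ ρ) ≡ ⟦ t ⟧ᵗ ρ
⟦suc⟧ k ρ = ⟦renameᵗ⟧ suc λ _ → refl

-- The conjunct ∃ z. z ≐ t excludes the bounds w < t, for which the quantifier would not reach t.
∀≤-Σ₁ : ∀ {n} {R : Vec ℕ (suc n) → Set} (t : Term n) → Σ₁ R → Σ₁ (λ ρ → ∀ k → k ≤ ⟦ t ⟧ᵗ ρ → R (k ∷ ρ))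
∀≤-Σ₁ {n} {R} t r = Σ₁-map (λ ρ → proj₂) (λ ρ h → (_ , sym (⟦suc⟧ _ ρ t)) , h) record
  { formula  = formula total ∧̇ ∀̇ (var zero ≼ renameᵗ suc t ⇒ formula r)
  ; sound    = λ {w} ρ h → sound′ w ρ (Sat-∧⁻ (formula total) (∀̇ (var zero ≼ renameᵗ suc t ⇒ formula r)) h)
  ; complete = λ ρ (e , h) → eventually-zip
      (λ {w} p q h → h p λ k _ k≤t → q k (transport (k ≤_) (⟦suc⟧ k ρ t) k≤t))
      (complete total ρ e) (eventually-all _ λ k k≤t → complete r (k ∷ ρ) (h k k≤t))
  }
  where
  total : Σ₁ (λ ρ → ∃ λ k → k ≡ ⟦ renameᵗ suc t ⟧ᵗ (k ∷ ρ))
  total = ∃-Σ₁ (≡-Σ₁ (var zero) (renameᵗ suc t))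

  sound′ : ∀ w ρ → Sat w ρ (formula total) × Sat w ρ (∀̇ (var zero ≼ renameᵗ suc t ⇒ formula r)) →
    (∃ λ k → k ≡ ⟦ renameᵗ suc t ⟧ᵗ (k ∷ ρ)) × (∀ k → k ≤ ⟦ t ⟧ᵗ ρ → R (k ∷ ρ))
  sound′ w ρ (e , h) = sound total ρ e , λ k k≤t →
    sound r (k ∷ ρ) (h k (≤-trans k≤t t≤w) (transport (k ≤_) (sym (⟦suc⟧ k ρ t)) k≤t))
    where
    t≤w : ⟦ t ⟧ᵗ ρ ≤ w
    t≤w with all-or-counterexample (λ k → ¬? (k ≟ ⟦ renameᵗ suc t ⟧ᵗ (k ∷ ρ))) w
    ... | inj₁ none             = ⊥-elim (e none)
    ... | inj₂ (k , k≤w , ¬¬eq) = transport (_≤ w)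
      (trans (decidable-stable (k ≟ _) ¬¬eq) (⟦suc⟧ k ρ t)) k≤w

∃*-Σ₁ : ∀ {n} m {R : Vec ℕ (m + n) → Set} → Σ₁ R → Σ₁ (λ ρ → ∃ λ (v : Vec ℕ m) → R (v ++ ρ))
∃*-Σ₁ zero    r = Σ₁-map (λ { ρ p → [] , p }) (λ { ρ ([] , p) → p }) r
∃*-Σ₁ (suc m) r = Σ₁-map (λ { ρ (v , k , p) → k ∷ v , p }) (λ { ρ (k ∷ v , p) → v , k , p }) (∃*-Σ₁ m (∃-Σ₁ r))

-- Cantor's pairing, opaque so that the checker does not unfold codes into sums of triangular numbers.
opaque
  pr : ℕ → ℕ → ℕ
  pr = pair

  pr≡pair : ∀ a b → pr a b ≡ pair a b
  pr≡pair a b = refl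

-- Cantor's pairing: injectivity and a polynomial form.

triangle-mono : ∀ {m n} → m ≤ n → triangle m ≤ triangle n
triangle-mono z≤n     = z≤n
triangle-mono (s≤s h) = +-mono-≤ (s≤s h) (triangle-mono h)

triangle-double : ∀ n → triangle n + triangle n ≡ n * suc n
triangle-double zero    = refl
triangle-double (suc n) = begin
  (suc n + triangle n) + (suc n + triangle n) ≡⟨ solve 2 (λ n t → (con 1 :+ n :+ t) :+ (con 1 :+ n :+ t)
                                                   := (t :+ t) :+ (con 2 :+ n :+ n)) refl n (triangle n) ⟩
  (triangle n + triangle n) + (2 + n + n)     ≡⟨ cong (_+ (2 + n + n)) (triangle-double n) ⟩
  n * suc n + (2 + n + n)                     ≡⟨ solve 1 (λ n → n :* (con 1 :+ n) :+ (con 2 :+ n :+ n)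
                                                   := (con 1 :+ n) :* (con 2 :+ n)) refl n ⟩
  suc n * suc (suc n)                         ∎
  where open ≡-Reasoning ; open +-*-Solver

-- The triangular numbers involve a division by 2, which no term of the language performs. Twice the
-- pairing is a polynomial, and comparing doubles defines the graph of `pr`.
pair-double : ∀ a b → pair a b + pair a b ≡ (a + b) * suc (a + b) + (b + b)
pair-double a b = trans
  (solve 2 (λ t b → (t :+ b) :+ (t :+ b) := (t :+ t) :+ (b :+ b)) refl (triangle (a + b)) b)
  (cong (_+ (b + b)) (triangle-double (a + b)))
  where open +-*-Solver

-- The pairs with sum s fill the interval from `triangle s` to `triangle s + s`, and
-- `triangle (suc s)` is the next number.
pair-< : ∀ a b c d → a + b < c + d → pair a b < pair c d
pair-< a b c d lt = begin-strict
  triangle (a + b) + b        <⟨ s≤s (+-monoʳ-≤ (triangle (a + b)) (m≤n+m b a)) ⟩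
  suc (triangle (a + b) + (a + b)) ≡⟨ cong suc (+-comm (triangle (a + b)) (a + b)) ⟩
  triangle (suc (a + b))      ≤⟨ triangle-mono lt ⟩
  triangle (c + d)            ≤⟨ m≤m+n _ d ⟩
  triangle (c + d) + d        ∎
  where open ≤-Reasoning

pair-injective : ∀ {a b c d} → pair a b ≡ pair c d → a ≡ c × b ≡ d
pair-injective {a} {b} {c} {d} eq with <-cmp (a + b) (c + d)
... | tri< lt _ _ = ⊥-elim (<-irrefl eq (pair-< a b c d lt))
... | tri> _ _ gt = ⊥-elim (<-irrefl (sym eq) (pair-< c d a b gt))
... | tri≈ _ s≡t _ = +-cancelʳ-≡ b a c (trans s≡t (cong (c +_) (sym b≡d))) , b≡d
  where
  b≡d : b ≡ d
  b≡d = +-cancelˡ-≡ (triangle (a + b)) b d (trans eq (cong (λ s → triangle s + d) (sym s≡t)))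

pr-injective : ∀ {a b c d} → pr a b ≡ pr c d → a ≡ c × b ≡ d
pr-injective {a} {b} {c} {d} eq = pair-injective (trans (sym (pr≡pair a b)) (trans eq (pr≡pair c d)))

double-injective : ∀ {m n} → m + m ≡ n + n → m ≡ n
double-injective {m} {n} eq = *-cancelˡ-≡ m n 2
  (trans (cong (m +_) (+-identityʳ m)) (trans eq (sym (cong (n +_) (+-identityʳ n)))))

-- Finite sets coded by divisors.

-- Gödel's moduli, pairwise coprime for p ≤ b if d = b !.
modulus : ℕ → ℕ → ℕ
modulus d p = suc (suc p * d)

Member : (b c d p : ℕ) → Set
Member b c d p = p ≤ b × (∃ λ q → q * modulus d p ≡ c)

-- A common divisor divides the difference d (e + 1). It is coprime to d, because it divides 1 + (p
-- + 1) d; so it divides e + 1, hence d by hypothesis, hence 1.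
coprime-moduli : ∀ {d p e} → suc e ∣ℕ d → Coprime (modulus d p) (modulus d (p + suc e))
coprime-moduli {d} {p} {e} e∣d {i} (i∣p , i∣q) = i∣d⇒i≡1 i∣p (∣-trans i∣e e∣d)
  where
  i∣d⇒i≡1 : ∀ {j} → j ∣ℕ modulus d p → j ∣ℕ d → j ≡ 1
  i∣d⇒i≡1 {j} j∣p j∣d = ∣1⇒≡1 (∣m+n∣m⇒∣n (transport (j ∣ℕ_) (+-comm 1 (suc p * d)) j∣p) (∣n⇒∣m*n (suc p) j∣d))

  diff : modulus d (p + suc e) ≡ modulus d p + d * suc e
  diff = solve 3 (λ p e d → con 1 :+ (con 1 :+ (p :+ (con 1 :+ e))) :* d
                         := (con 1 :+ (con 1 :+ p) :* d) :+ d :* (con 1 :+ e)) refl p e d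
    where open +-*-Solver

  i∣e : i ∣ℕ suc e
  i∣e = coprime-divisor {n = d} (λ (j∣i , j∣d) → i∣d⇒i≡1 (∣-trans j∣i i∣p) j∣d)
    (∣m+n∣m⇒∣n (transport (i ∣ℕ_) diff i∣q) i∣p)

-- The sum of the entries serves merely as a bound b, and d = b ! is divisible by every difference
-- of numbers up to b. If p ≤ b is no entry, its modulus is coprime to each factor of c, so it could
-- divide c only by being 1, but d is positive. Sets need divisibility alone, so the Chinese
-- remainder theorem does not enter, and repeated entries are harmless.
finite-set-code : ∀ L → ∃ λ b → ∃ λ c → ∃ λ d → ∀ p → (p ∈ L → Member b c d p) × (Member b c d p → p ∈ L)
finite-set-code L = b , product (map (modulus d) L) , d , λ p → member L (sum-bound L) , ∈L p
  where
  b = sum L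
  d = b !

  sum-bound : ∀ L {p} → p ∈ L → p ≤ sum L
  sum-bound (x ∷ L) (here refl) = m≤m+n x _
  sum-bound (x ∷ L) (there p∈L) = ≤-trans (sum-bound L p∈L) (m≤n+m _ x)

  member : ∀ L {p} → (∀ {q} → q ∈ L → q ≤ b) → p ∈ L → Member b (product (map (modulus d) L)) d p
  member (x ∷ L) h (here refl) = h (here refl) , product (map (modulus d) L) ,
      *-comm (product (map (modulus d) L)) (modulus d x)
  member (x ∷ L) {p} h (there p∈L) with member L (h ∘ there) p∈L
  ... | p≤b , q , eq = p≤b , modulus d x * q , trans (*-assoc (modulus d x) q (modulus d p))
      (cong (modulus d x *_) eq)

  small∣d : ∀ {e} → suc e ≤ b → suc e ∣ℕ d
  small∣d {e} le = ∣-trans (m∣m*n (e !)) (m≤n⇒m!∣n! le)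

  coprime : ∀ {p q} → p ≤ b → q ≤ b → p ≢ q → Coprime (modulus d p) (modulus d q)
  coprime {p} {q} p≤b q≤b p≢q with <-cmp p q
  ... | tri≈ _ p≡q _ = ⊥-elim (p≢q p≡q)
  ... | tri< lt _ _ with m≤n⇒∃[o]m+o≡n lt
  ...   | e , refl = transport (λ n → Coprime (modulus d p) (modulus d n)) (ℕ-+-suc p e)
                       (coprime-moduli {p = p} (small∣d (≤-trans (s≤s (m≤n+m e p)) q≤b)))
  coprime {p} {q} p≤b q≤b p≢q | tri> _ _ gt with m≤n⇒∃[o]m+o≡n gt
  ...   | e , refl = coprime-sym (transport (λ n → Coprime (modulus d q) (modulus d n)) (ℕ-+-suc q e)
                       (coprime-moduli {p = q} (small∣d (≤-trans (s≤s (m≤n+m e q)) p≤b))))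

  ∣product⇒≡1 : ∀ {m} L → (∀ {q} → q ∈ L → Coprime m (modulus d q)) → m ∣ℕ product (map (modulus d) L) → m ≡ 1
  ∣product⇒≡1 []      h m∣1 = ∣1⇒≡1 m∣1
  ∣product⇒≡1 (x ∷ L) h m∣  = ∣product⇒≡1 L (h ∘ there) (coprime-divisor (h (here refl)) m∣)

  ∈L : ∀ p → Member b (product (map (modulus d) L)) d p → p ∈ L
  ∈L p (p≤b , q , eq) with p ∈? L
  ... | yes p∈L = p∈L
  ... | no p∉L  = ⊥-elim (≢-nonZero⁻¹ (suc p * d) ⦃ m*n≢0 (suc p) d ⦃ _ ⦄ ⦃ b !≢0 ⦄ ⦄
    (suc-injective (∣product⇒≡1 L
      (λ {r} r∈L → coprime p≤b (sum-bound L r∈L) λ { refl → p∉L r∈L }) (divides q (sym eq)))))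

-- Expressions built with pairing, and their graphs.

data Expr (k : ℕ) : Set where
  varᵉ  : Fin k → Expr k
  conᵉ  : ℕ → Expr k
  sucᵉ  : Expr k → Expr k
  prᵉ   : Expr k → Expr k → Expr k

⟦_⟧ᵉ : ∀ {k} → Expr k → (Fin k → ℕ) → ℕ
⟦ varᵉ i ⟧ᵉ  ρ = ρ i
⟦ conᵉ c ⟧ᵉ  ρ = c
⟦ sucᵉ t ⟧ᵉ  ρ = suc (⟦ t ⟧ᵉ ρ)
⟦ prᵉ s t ⟧ᵉ ρ = pr (⟦ s ⟧ᵉ ρ) (⟦ t ⟧ᵉ ρ)

⟦⟧ᵉ-cong : ∀ {k} {ρ ρ′ : Fin k → ℕ} → (∀ i → ρ i ≡ ρ′ i) → ∀ t → ⟦ t ⟧ᵉ ρ ≡ ⟦ t ⟧ᵉ ρ′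
⟦⟧ᵉ-cong eq (varᵉ i)  = eq i
⟦⟧ᵉ-cong eq (conᵉ c)  = refl
⟦⟧ᵉ-cong eq (sucᵉ t)  = cong suc (⟦⟧ᵉ-cong eq t)
⟦⟧ᵉ-cong eq (prᵉ s t) = cong₂ pr (⟦⟧ᵉ-cong eq s) (⟦⟧ᵉ-cong eq t)

⟦num⟧ : ∀ {n} c (ρ : Vec ℕ n) → ⟦ num c ⟧ᵗ ρ ≡ c
⟦num⟧ zero    ρ = refl
⟦num⟧ (suc c) ρ = cong suc (⟦num⟧ c ρ)

pr-Σ₁ : ∀ {n} (s t u : Term n) → Σ₁ (λ ρ → pr (⟦ s ⟧ᵗ ρ) (⟦ t ⟧ᵗ ρ) ≡ ⟦ u ⟧ᵗ ρ)
pr-Σ₁ s t u = Σ₁-map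
  (λ ρ eq → double-injective (trans (pr-double (⟦ s ⟧ᵗ ρ) (⟦ t ⟧ᵗ ρ)) eq))
  (λ ρ eq → trans (sym (pr-double (⟦ s ⟧ᵗ ρ) (⟦ t ⟧ᵗ ρ))) (cong₂ _+_ eq eq))
  (≡-Σ₁ ((s +ᵗ t) ·ᵗ sucᵗ (s +ᵗ t) +ᵗ (t +ᵗ t)) (u +ᵗ u))
  where
  pr-double : ∀ a b → pr a b + pr a b ≡ (a + b) * suc (a + b) + (b + b)
  pr-double a b = trans (cong₂ _+_ (pr≡pair a b) (pr≡pair a b)) (pair-double a b)

-- Pairing is not a function symbol of arithmetic, so the value of each proper subexpression is
-- introduced by an existential quantifier. The successor case needs this as well, since pairs may
-- occur below it.
expr-Σ₁ : ∀ {k n} (e : Expr k) (θ : Fin k → Term n) (t : Term n) →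
  Σ₁ (λ ρ → ⟦ e ⟧ᵉ (λ i → ⟦ θ i ⟧ᵗ ρ) ≡ ⟦ t ⟧ᵗ ρ)
expr-Σ₁ (varᵉ i) θ t = ≡-Σ₁ (θ i) t
expr-Σ₁ (conᵉ c) θ t = Σ₁-map (λ ρ → trans (sym (⟦num⟧ c ρ))) (λ ρ → trans (⟦num⟧ c ρ)) (≡-Σ₁ (num c) t)
expr-Σ₁ (sucᵉ e) θ t = Σ₁-map
  (λ { ρ (k , p , q) → trans (cong suc (trans (shift k ρ) p)) (trans q (⟦suc⟧ k ρ t)) })
  (λ { ρ eq → _ , sym (shift _ ρ) , trans eq (sym (⟦suc⟧ _ ρ t)) })
  (∃-Σ₁ (expr-Σ₁ e (renameᵗ suc ∘ θ) (var zero) ×-Σ₁ ≡-Σ₁ (sucᵗ (var zero)) (renameᵗ suc t)))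
  where
  shift : ∀ k ρ → ⟦ e ⟧ᵉ (λ i → ⟦ θ i ⟧ᵗ ρ) ≡ ⟦ e ⟧ᵉ (λ i → ⟦ renameᵗ suc (θ i) ⟧ᵗ (k ∷ ρ))
  shift k ρ = ⟦⟧ᵉ-cong (λ i → sym (⟦suc⟧ k ρ (θ i))) e
expr-Σ₁ (prᵉ d e) θ t = Σ₁-map
  (λ { ρ (j , k , p , q , r) → trans (cong₂ pr (trans (shift d j k ρ) p) (trans (shift e j k ρ) q))
      (trans r (shiftᵗ j k ρ t)) })
  (λ { ρ eq → _ , _ , sym (shift d _ _ ρ) , sym (shift e _ _ ρ) , trans eq (sym (shiftᵗ _ _ ρ t)) })
  (∃-Σ₁ (∃-Σ₁ (expr-Σ₁ d (renameᵗ suc ∘ renameᵗ suc ∘ θ) (var (suc zero)) ×-Σ₁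
               expr-Σ₁ e (renameᵗ suc ∘ renameᵗ suc ∘ θ) (var zero) ×-Σ₁
               pr-Σ₁ (var (suc zero)) (var zero) (renameᵗ suc (renameᵗ suc t)))))
  where
  shiftᵗ : ∀ j k ρ t → ⟦ renameᵗ suc (renameᵗ suc t) ⟧ᵗ (k ∷ j ∷ ρ) ≡ ⟦ t ⟧ᵗ ρ
  shiftᵗ j k ρ t = trans (⟦suc⟧ k (j ∷ ρ) (renameᵗ suc t)) (⟦suc⟧ j ρ t)

  shift : ∀ e j k ρ → ⟦ e ⟧ᵉ (λ i → ⟦ θ i ⟧ᵗ ρ) ≡ ⟦ e ⟧ᵉ
      (λ i → ⟦ renameᵗ suc (renameᵗ suc (θ i)) ⟧ᵗ (k ∷ j ∷ ρ))
  shift e j k ρ = ⟦⟧ᵉ-cong (λ i → sym (shiftᵗ j k ρ (θ i))) e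

all-Σ₁ : ∀ {n} {A : Set} {R : A → Vec ℕ n → Set} → (∀ a → Σ₁ (R a)) → ∀ as → Σ₁ (λ ρ → All (λ a → R a ρ) as)
all-Σ₁ r []       = Σ₁-map (λ ρ _ → []) (λ ρ _ → refl) (≡-Σ₁ zeroᵗ zeroᵗ)
all-Σ₁ r (a ∷ as) = Σ₁-map (λ { ρ (p , ps) → p ∷ ps }) (λ { ρ (p ∷ ps) → p , ps }) (r a ×-Σ₁ all-Σ₁ r as)

any-Σ₁ : ∀ {n} {A : Set} {R : A → Vec ℕ n → Set} → (∀ a → Σ₁ (R a)) → ∀ as → Σ₁ (λ ρ → Any (λ a → R a ρ) as)
any-Σ₁ r []       = Σ₁-map (λ ρ ()) (λ ρ ()) ⊥-Σ₁
any-Σ₁ r (a ∷ as) = Σ₁-map (λ { ρ (inj₁ p) → here p ; ρ (inj₂ p) → there p })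
  (λ { ρ (here p) → inj₁ p ; ρ (there p) → inj₂ p }) (r a ⊎-Σ₁ any-Σ₁ r as)

-- Horn programs and their derivations as justified sets.

-- The number of a predicate symbol, and its three arguments.
Fact : Set
Fact = ℕ × ℕ × ℕ × ℕ

factCode : Fact → ℕ
factCode (τ , a , b , c) = pr τ (pr a (pr b c))

factCode-injective : ∀ f g → factCode f ≡ factCode g → f ≡ g
factCode-injective f g eq with pr-injective eq
... | refl , eq′ with pr-injective eq′
... | refl , eq″ with pr-injective eq″
... | refl , refl = refl

Atom : ℕ → Set
Atom k = ℕ × Expr k × Expr k × Expr k

⟦_⟧ᵃ : ∀ {k} → Atom k → (Fin k → ℕ) → Fact
⟦ τ , a , b , c ⟧ᵃ ρ = τ , ⟦ a ⟧ᵉ ρ , ⟦ b ⟧ᵉ ρ , ⟦ c ⟧ᵉ ρ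

atomExpr : ∀ {k} → Atom k → Expr k
atomExpr (τ , a , b , c) = prᵉ (conᵉ τ) (prᵉ a (prᵉ b c))

infix 3 ∀[_]_:-_

record Clause : Set where
  constructor ∀[_]_:-_
  field
    arity : ℕ
    head    : Atom arity
    body    : List (Atom arity)

open Clause

Program : Set
Program = List Clause

data Derivable (P : Program) : Fact → Set where
  fire : ∀ {C} → C ∈ P → (v : Vec ℕ (arity C)) →
         All (λ a → Derivable P (⟦ a ⟧ᵃ (lookup v))) (body C) → Derivable P (⟦ head C ⟧ᵃ (lookup v))

-- Premises must have smaller rank than the conclusion. Without ranks, facts that support one
-- another in a circle would count as justified.
ranked : ℕ → Fact → ℕ
ranked i f = pr i (factCode f)

JustifiedBy : (ℕ → Set) → ℕ → Clause → Set
JustifiedBy S p C = ∃ λ i → ∃ λ v → ranked i (⟦ head C ⟧ᵃ (lookup v)) ≡ p ×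
  All (λ a → ∃ λ j → j < i × S (ranked j (⟦ a ⟧ᵃ (lookup v)))) (body C)

Justified : Program → (ℕ → Set) → ℕ → Set
Justified P S p = Any (JustifiedBy S p) P

Justified-mono : ∀ {P} {S S′ : ℕ → Set} → (∀ p → S p → S′ p) → ∀ {p} → Justified P S p → Justified P S′ p
Justified-mono f = Any.map λ (i , v , eq , prems) → i , v , eq ,
    All.map (λ (j , j<i , s) → j , j<i , f _ s) prems

-- Strong induction on the rank. Finiteness of `S` is irrelevant, as the ranks alone are well
-- founded.
justified⇒derivable : ∀ {P S} → (∀ p → S p → Justified P S p) → ∀ i f → S (ranked i f) → Derivable P f
justified⇒derivable {P} {S} just = <-rec (λ i → ∀ f → S (ranked i f) → Derivable P f) λ i rec f s →
    step rec f (just _ s)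
  where
  step : ∀ {i} → (∀ {j} → j < i → ∀ f → S (ranked j f) → Derivable P f) → ∀ f → Justified P S (ranked i f) →
      Derivable P f
  step {i} rec f just with find just
  ... | C , C∈P , i′ , v , eq , prems with pr-injective eq
  ... | refl , eq′ with factCode-injective (⟦ head C ⟧ᵃ (lookup v)) f eq′
  ... | refl = fire C∈P v (All.map (λ {a} (j , j<i , s) → rec j<i (⟦ a ⟧ᵃ (lookup v)) s) prems)

derivable⇒justified : ∀ {P f} → Derivable P f → ∃ λ L → ∃ λ i → ranked i f ∈ L ×
    (∀ {p} → p ∈ L → Justified P (_∈ L) p)
premises-justified : ∀ {P k} {v : Vec ℕ k} {as} → All (λ a → Derivable P (⟦ a ⟧ᵃ (lookup v))) as →
  ∃ λ L → ∃ λ i → All (λ a → ∃ λ j → j < i × ranked j (⟦ a ⟧ᵃ (lookup v)) ∈ L) as ×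
      (∀ {p} → p ∈ L → Justified P (_∈ L) p)

derivable⇒justified {P} (fire {C} C∈P v ds) with premises-justified {v = v} ds
... | L , i , prems , just = p ∷ L , i , here refl , λ where
    (here refl) → Justified-mono {S = _∈ L} (λ _ → there) (lose C∈P (i , v , refl , prems))
    (there p∈L) → Justified-mono {S = _∈ L} (λ _ → there) (just p∈L)
  where p = ranked i (⟦ head C ⟧ᵃ (lookup v))

premises-justified [] = [] , 0 , [] , λ ()
premises-justified {v = v} (d ∷ ds) with derivable⇒justified d | premises-justified {v = v} ds
... | L , i , p∈L , just | L′ , i′ , prems , just′ =
  -- `i` is the rank of the first premise itself, `i′` a strict bound for the ranks of the others;
  -- the successor of the sum lies strictly above all of them.
  L ++ˡ L′ , suc (i + i′) ,
  (i , s≤s (m≤m+n i i′) , ∈-++⁺ˡ p∈L) ∷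
    All.map (λ {a} (j , j<i , q) → j , ≤-trans j<i (m≤n⇒m≤1+n (m≤n+m i′ i)) , ∈-++⁺ʳ L q) prems ,
  λ p∈ → case ∈-++⁻ L p∈ of λ where
    (inj₁ p∈L)  → Justified-mono {S = _∈ L} (λ _ → ∈-++⁺ˡ) (just p∈L)
    (inj₂ p∈L′) → Justified-mono {S = _∈ L′} (λ _ → ∈-++⁺ʳ L) (just′ p∈L′)

-- Derivability from a Horn program is Σ₁.

module _ (P : Program) where

  private
    #0 : ∀ {n} → Fin (1 + n)
    #0 = zero
    #1 : ∀ {n} → Fin (2 + n)
    #1 = suc zero
    #2 : ∀ {n} → Fin (3 + n)
    #2 = suc (suc zero)
    #3 : ∀ {n} → Fin (4 + n)
    #3 = suc (suc (suc zero))

    member-Σ₁ : ∀ {n} (b c d p : Fin n) → Σ₁ (λ ρ → Member (lookup ρ b) (lookup ρ c) (lookup ρ d) (lookup ρ p))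
    member-Σ₁ b c d p = ≤-Σ₁ (var p) (var b) ×-Σ₁
      ∃-Σ₁ (≡-Σ₁ (var zero ·ᵗ sucᵗ (sucᵗ (var (suc p)) ·ᵗ var (suc d))) (var (suc c)))

    member′-Σ₁ : ∀ {k n} (b c d i : Fin n) (a : Atom k) (x : Fin k → Fin n) →
      Σ₁ (λ ρ → Member (lookup ρ b) (lookup ρ c) (lookup ρ d) (ranked (lookup ρ i) (⟦ a ⟧ᵃ (lookup ρ ∘ x))))
    member′-Σ₁ b c d i a x = Σ₁-map
      (λ { ρ (y , p , refl , refl , m) → m })
      (λ { ρ m → _ , _ , refl , refl , m })
      (∃-Σ₁ (∃-Σ₁ (expr-Σ₁ (atomExpr a) (λ j → var (suc (suc (x j)))) (var #1) ×-Σ₁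
        pr-Σ₁ (var (suc (suc i))) (var #1) (var #0) ×-Σ₁
        member-Σ₁ (suc (suc b)) (suc (suc c)) (suc (suc d)) #0)))

    -- Below the quantifier for the rank the environment reads rank, p, d, c, b. The variables of
    -- the clause are then quantified as one vector `v` in front of it, and the transports with
    -- `lookup-++ˡ` and `lookup-++ʳ` only translate positions.
    justifiedBy-Σ₁ : ∀ {n} C → Σ₁ {4 + n} (λ ρ → JustifiedBy (Member (lookup ρ #3) (lookup ρ #2) (lookup ρ #1))
        (lookup ρ #0) C)
    justifiedBy-Σ₁ {n} C = ∃-Σ₁ {R = λ ρ → ∃ λ v → ranked (lookup ρ #0) (⟦ head C ⟧ᵃ (lookup v)) ≡ lookup ρ #1 ×
        All (λ a → ∃ λ j → j < lookup ρ #0 × Member (lookup ρ #4) (lookup ρ #3) (lookup ρ #2)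
            (ranked j (⟦ a ⟧ᵃ (lookup v)))) (body C)} (Σ₁-map
      (λ { (i ∷ p ∷ d ∷ c ∷ b ∷ ρ) (v , (y , e , r) , prems) → v ,
          trans (cong (pr i) (trans (⟦⟧ᵉ-cong (λ j → sym (lookup-++ˡ v (i ∷ p ∷ d ∷ c ∷ b ∷ ρ) j))
              (atomExpr (head C))) e))
            (trans (cong (λ i → pr i y) (sym (lookup-++ʳ v (i ∷ p ∷ d ∷ c ∷ b ∷ ρ) #0)))
                (trans r (lookup-++ʳ v (i ∷ p ∷ d ∷ c ∷ b ∷ ρ) #1))) ,
          All.map (λ {a} (j , lt , m) → j , transport (j <_) (lookup-++ʳ v (i ∷ p ∷ d ∷ c ∷ b ∷ ρ) #0) lt ,
              transport id (eq v i p d c b ρ j a) m) prems })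
      (λ { (i ∷ p ∷ d ∷ c ∷ b ∷ ρ) (v , r , prems) → v ,
          (_ , refl , trans (cong₂ pr (lookup-++ʳ v (i ∷ p ∷ d ∷ c ∷ b ∷ ρ) #0)
              (⟦⟧ᵉ-cong (λ j → lookup-++ˡ v (i ∷ p ∷ d ∷ c ∷ b ∷ ρ) j) (atomExpr (head C))))
            (trans r (sym (lookup-++ʳ v (i ∷ p ∷ d ∷ c ∷ b ∷ ρ) #1)))) ,
          All.map (λ {a} (j , lt , m) → j , transport (j <_)
              (sym (lookup-++ʳ v (i ∷ p ∷ d ∷ c ∷ b ∷ ρ) #0)) lt , transport id (sym (eq v i p d c b ρ j a)) m)
              prems })
      (∃*-Σ₁ k {λ ρ → (∃ λ y → ⟦ atomExpr (head C) ⟧ᵉ (λ j → lookup ρ (j ↑ˡ m)) ≡ y ×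
          pr (lookup ρ (k ↑ʳ #0)) y ≡ lookup ρ (k ↑ʳ #1)) ×
                    All (λ a → ∃ λ j → j < lookup ρ (k ↑ʳ #0) ×
                        Member (lookup ρ (k ↑ʳ #4)) (lookup ρ (k ↑ʳ #3)) (lookup ρ (k ↑ʳ #2))
                                        (ranked j (⟦ a ⟧ᵃ (λ j → lookup ρ (j ↑ˡ m))))) (body C)}
        (∃-Σ₁ (expr-Σ₁ (atomExpr (head C)) (λ j → var (suc (j ↑ˡ m))) (var zero) ×-Σ₁
               pr-Σ₁ (var (suc (k ↑ʳ #0))) (var zero) (var (suc (k ↑ʳ #1)))) ×-Σ₁
         all-Σ₁ (λ a → ∃-Σ₁ (≤-Σ₁ (sucᵗ (var zero)) (var (suc (k ↑ʳ #0))) ×-Σ₁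
           member′-Σ₁ (suc (k ↑ʳ #4)) (suc (k ↑ʳ #3)) (suc (k ↑ʳ #2)) zero a (λ j → suc (j ↑ˡ m)))) (body C))))
      where
      m = 5 + n
      k = arity C
      #4 : ∀ {n} → Fin (5 + n)
      #4 = suc #3

      eq : ∀ (v : Vec ℕ k) i p d c b (ρ : Vec ℕ n) j (a : Atom k) → let ρ′ = v ++ (i ∷ p ∷ d ∷ c ∷ b ∷ ρ) in
        Member (lookup ρ′ (k ↑ʳ #4)) (lookup ρ′ (k ↑ʳ #3)) (lookup ρ′ (k ↑ʳ #2))
            (ranked j (⟦ a ⟧ᵃ (λ j → lookup ρ′ (j ↑ˡ m))))
        ≡ Member b c d (ranked j (⟦ a ⟧ᵃ (lookup v)))
      eq v i p d c b ρ j a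
        rewrite lookup-++ʳ v (i ∷ p ∷ d ∷ c ∷ b ∷ ρ) #4 | lookup-++ʳ v (i ∷ p ∷ d ∷ c ∷ b ∷ ρ) #3 | lookup-++ʳ v
            (i ∷ p ∷ d ∷ c ∷ b ∷ ρ) #2
        = cong (λ y → Member b c d (pr j y)) (⟦⟧ᵉ-cong (lookup-++ˡ v (i ∷ p ∷ d ∷ c ∷ b ∷ ρ)) (atomExpr a))

    justified-Σ₁ : ∀ {n} → Σ₁ {4 + n} (λ ρ → Justified P (Member (lookup ρ #3) (lookup ρ #2) (lookup ρ #1))
        (lookup ρ #0))
    justified-Σ₁ = any-Σ₁ justifiedBy-Σ₁ P

    nonmember-Σ₁ : ∀ {n} → Σ₁ {4 + n} (λ ρ → ∀ q → q ≤ lookup ρ #2 →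
        q * modulus (lookup ρ #1) (lookup ρ #0) ≢ lookup ρ #2)
    nonmember-Σ₁ = ∀≤-Σ₁ (var #2) (≢-Σ₁ (var #0 ·ᵗ sucᵗ (sucᵗ (var #1) ·ᵗ var #2)) (var #3))

  -- The formula asks for a coded set that contains the fact at some rank and in which each p ≤ b is
  -- a non-member or justified. Σ₁ relations are not closed under negation, so non-membership is
  -- written out with q ≤ c; this loses nothing, because a q with `q * modulus d p ≡ c` is at most
  -- c.
  derivable-Σ₁ : ∀ {k} (a : Atom k) → Σ₁ (λ v → Derivable P (⟦ a ⟧ᵃ (lookup v)))
  derivable-Σ₁ a = Σ₁-map
    (λ { v (b , c , d , (i , m) , just) → justified⇒derivable (to-justified just) i _ m })
    from-derivable
    (∃-Σ₁ (∃-Σ₁ (∃-Σ₁ (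
      ∃-Σ₁ (member′-Σ₁ #3 #2 #1 #0 a (λ j → suc (suc (suc (suc j))))) ×-Σ₁
      ∀≤-Σ₁ (var #2) (nonmember-Σ₁ ⊎-Σ₁ justified-Σ₁)))))
    where
    Certified : (b c d : ℕ) → Set
    Certified b c d = ∀ p → p ≤ b → (∀ q → q ≤ c → q * modulus d p ≢ c) ⊎ Justified P (Member b c d) p

    to-justified : ∀ {b c d} → Certified b c d → ∀ p → Member b c d p → Justified P (Member b c d) p
    to-justified {d = d} cert p (p≤b , q , eq) with cert p p≤b
    ... | inj₁ ¬m   = ⊥-elim (¬m q (transport (q ≤_) eq (m≤m*n q (modulus d p))) eq)
    ... | inj₂ just = just

    from-derivable : ∀ v → Derivable P (⟦ a ⟧ᵃ (lookup v)) → ∃ λ b → ∃ λ c → ∃ λ d →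
      (∃ λ i → Member b c d (ranked i (⟦ a ⟧ᵃ (lookup v)))) × Certified b c d
    from-derivable v der with derivable⇒justified der
    ... | L , i , ∈L , just with finite-set-code L
    ... | b , c , d , code = b , c , d , (i , proj₁ (code _) ∈L) , cert
      where
      cert : Certified b c d
      cert p p≤b with p ∈? L
      ... | yes p∈L = inj₂ (Justified-mono (λ p → proj₁ (code p)) (just p∈L))
      ... | no p∉L  = inj₁ λ q _ eq → p∉L (proj₂ (code p) (p≤b , q , eq))

-- Codes of syntax, recursive functions and substitutions.

termTag : ∀ {n} → Term n → ℕ
termTag (var _)  = 0
termTag zeroᵗ    = 1
termTag (sucᵗ _) = 2
termTag (_ +ᵗ _) = 3
termTag (_ ·ᵗ _) = 4

-- ⌜_⌝ᵗ and ⌜_⌝ with pr in place of pair; the tag is split off so that a code equation can be inverted by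
-- matching on it.
mutual
  termCode : ∀ {n} → Term n → ℕ
  termCode t = pr (termTag t) (termArgs t)

  termArgs : ∀ {n} → Term n → ℕ
  termArgs (var i)  = toℕ i
  termArgs zeroᵗ    = 0
  termArgs (sucᵗ t) = termCode t
  termArgs (s +ᵗ t) = pr (termCode s) (termCode t)
  termArgs (s ·ᵗ t) = pr (termCode s) (termCode t)

formulaTag : ∀ {n} → Formula n → ℕ
formulaTag ⊥̇       = 0
formulaTag (_ ≐ _) = 1
formulaTag (_ ≼ _) = 2
formulaTag (_ ⇒ _) = 3
formulaTag (∀̇ _)   = 4

mutual
  formulaCode : ∀ {n} → Formula n → ℕ
  formulaCode φ = pr (formulaTag φ) (formulaArgs φ)

  formulaArgs : ∀ {n} → Formula n → ℕ
  formulaArgs ⊥̇       = 0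
  formulaArgs (s ≐ t) = pr (termCode s) (termCode t)
  formulaArgs (s ≼ t) = pr (termCode s) (termCode t)
  formulaArgs (φ ⇒ ψ) = pr (formulaCode φ) (formulaCode ψ)
  formulaArgs (∀̇ φ)   = formulaCode φ

termCode≡ : ∀ {n} (t : Term n) → termCode t ≡ ⌜ t ⌝ᵗ
termCode≡ (var i)  = pr≡pair 0 (toℕ i)
termCode≡ zeroᵗ    = pr≡pair 1 0
termCode≡ (sucᵗ t) = trans (pr≡pair 2 _) (cong (pair 2) (termCode≡ t))
termCode≡ (s +ᵗ t) = trans (pr≡pair 3 _) (cong (pair 3) (trans (pr≡pair _ _)
    (cong₂ pair (termCode≡ s) (termCode≡ t))))
termCode≡ (s ·ᵗ t) = trans (pr≡pair 4 _) (cong (pair 4) (trans (pr≡pair _ _)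
    (cong₂ pair (termCode≡ s) (termCode≡ t))))

formulaCode≡ : ∀ {n} (φ : Formula n) → formulaCode φ ≡ ⌜ φ ⌝
formulaCode≡ ⊥̇       = pr≡pair 0 0
formulaCode≡ (s ≐ t) = trans (pr≡pair 1 _) (cong (pair 1)
    (trans (pr≡pair _ _) (cong₂ pair (termCode≡ s) (termCode≡ t))))
formulaCode≡ (s ≼ t) = trans (pr≡pair 2 _) (cong (pair 2)
    (trans (pr≡pair _ _) (cong₂ pair (termCode≡ s) (termCode≡ t))))
formulaCode≡ (φ ⇒ ψ) = trans (pr≡pair 3 _) (cong (pair 3)
    (trans (pr≡pair _ _) (cong₂ pair (formulaCode≡ φ) (formulaCode≡ ψ))))
formulaCode≡ (∀̇ φ)   = trans (pr≡pair 4 _) (cong (pair 4) (formulaCode≡ φ))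

listCode : List ℕ → ℕ
listCode []       = 0
listCode (x ∷ xs) = suc (pr x (listCode xs))

vecCode : ∀ {n} → Vec ℕ n → ℕ
vecCode v = listCode (toList v)

contextCode : ∀ {n} → List (Formula n) → ℕ
contextCode Γ = listCode (map formulaCode Γ)

codeTag : ∀ {n} → Code n → ℕ
codeTag zeroᶜ      = 0
codeTag sucᶜ       = 1
codeTag (proj _)   = 2
codeTag (comp _ _) = 3
codeTag (prec _ _) = 4
codeTag (μ _)      = 5

mutual
  codeCode : ∀ {n} → Code n → ℕ
  codeCode c = pr (codeTag c) (codeArgs c)

  codeArgs : ∀ {n} → Code n → ℕ
  codeArgs zeroᶜ       = 0
  codeArgs sucᶜ        = 0
  codeArgs (proj i)    = toℕ i
  codeArgs (comp f gs) = pr (codeCode f) (codesCode gs)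
  codeArgs (prec f g)  = pr (codeCode f) (codeCode g)
  codeArgs (μ f)       = codeCode f

  codesCode : ∀ {n m} → Vec (Code n) m → ℕ
  codesCode []       = 0
  codesCode (g ∷ gs) = suc (pr (codeCode g) (codesCode gs))

-- The substitutions that occur in the rules of the calculus.
data Env : ℕ → ℕ → Set where
  shiftᵉ  : ∀ {n} → Env n (suc n)
  singleᵉ : ∀ {n} → Term n → Env (suc n) n
  liftᵉ   : ∀ {m n} → Env m n → Env (suc m) (suc n)
  emptyᵉ  : ∀ {n} → Env 0 n

⟦_⟧ˢ : ∀ {m n} → Env m n → Fin m → Term n
⟦ shiftᵉ ⟧ˢ    = var ∘ suc
⟦ singleᵉ t ⟧ˢ = single t
⟦ liftᵉ e ⟧ˢ   = exts ⟦ e ⟧ˢ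
⟦ emptyᵉ ⟧ˢ    = λ ()

envTag : ∀ {m n} → Env m n → ℕ
envTag shiftᵉ      = 0
envTag (singleᵉ _) = 1
envTag (liftᵉ _)   = 2
envTag emptyᵉ      = 3

-- An environment code starts with the number of variables of the codomain: a term does not determine it.
mutual
  envCode : ∀ {m n} → Env m n → ℕ
  envCode {n = n} e = pr n (pr (envTag e) (envArgs e))

  envArgs : ∀ {m n} → Env m n → ℕ
  envArgs shiftᵉ      = 0
  envArgs (singleᵉ t) = termCode t
  envArgs (liftᵉ e)   = envCode e
  envArgs emptyᵉ      = 0

-- Horn clauses for substitution, provability and evaluation.

-- The predicates: lt i n (i < n), nth l i x (x is the i-th entry of l), numˢ k t (t is the numeral of k),
-- look e i t (e maps the variable i to t), subT e s t and subF e φ ψ (e applied to a term, a formula),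
-- wk n γ γ′ (γ′ is the weakening of γ), prov n γ φ (γ ⊢ φ in n variables), ev f v y (f ⟨ v ⟩↓ y),
-- evs fs v ys (fs ⟨ v ⟩⇊ ys), nz f v k (f is positive at i ∷ v for i < k),
-- thm φ and ref φ (φ(⌜φ⌝) is provable, refutable).  Unused arguments are 0.
pattern lt   = 0
pattern nth  = 1
pattern numˢ = 2
pattern look = 3
pattern subT = 4
pattern subF = 5
pattern wk   = 6
pattern prov = 7
pattern ev   = 8
pattern evs  = 9
pattern nz   = 10
pattern thm  = 11
pattern ref  = 12

pattern 0ᵉ = conᵉ 0

module _ {n : ℕ} where

  x₀ : Expr (1 + n)
  x₀ = varᵉ zero
  x₁ : Expr (2 + n)
  x₁ = varᵉ (suc zero)
  x₂ : Expr (3 + n)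
  x₂ = varᵉ (suc (suc zero))
  x₃ : Expr (4 + n)
  x₃ = varᵉ (suc (suc (suc zero)))
  x₄ : Expr (5 + n)
  x₄ = varᵉ (suc (suc (suc (suc zero))))
  x₅ : Expr (6 + n)
  x₅ = varᵉ (suc (suc (suc (suc (suc zero)))))

  infixr 5 _∷ᵉ_

  _∷ᵉ_ : Expr n → Expr n → Expr n
  a ∷ᵉ l = sucᵉ (prᵉ a l)

  tagged : ℕ → Expr n → Expr n
  tagged c a = prᵉ (conᵉ c) a

  tagged₂ : ℕ → Expr n → Expr n → Expr n
  tagged₂ c a b = tagged c (prᵉ a b)

  -- This and the next three follow `envCode`. For a shift, n counts the variables of the domain,
  -- one fewer than the codomain. In `liftˣ n e`, the code of the inner environment is `prᵉ n e`, so
  -- `e` is that code without its leading component; a clause can thus read n off and still pass on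
  -- the whole code.
  shiftˣ : Expr n → Expr n
  shiftˣ n = prᵉ (sucᵉ n) (tagged 0 0ᵉ)

  singleˣ : Expr n → Expr n → Expr n
  singleˣ n t = prᵉ n (tagged 1 t)

  liftˣ : Expr n → Expr n → Expr n
  liftˣ n e = prᵉ (sucᵉ n) (tagged 2 (prᵉ n e))

  emptyˣ : Expr n → Expr n
  emptyˣ n = prᵉ n (tagged 3 0ᵉ)

-- axioms is the code of a partial recursive function with value 1 on the Gödel numbers of axioms.
module Provability (axioms : ℕ) where

  lt-zero lt-suc nth-zero nth-suc num-zero num-suc look-shift look-single-zero look-single-suc look-lift-zero
      look-lift-suc
    subT-var subT-zero subT-suc subT-+ subT-· subF-⊥ subF-≐ subF-≼ subF-⇒ subF-∀ wk-[] wk-∷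
    prov-axiom prov-hyp prov-⇒I prov-⇒E prov-raa prov-∀I prov-∀E prov-≐I prov-≐E
    ev-zero ev-suc ev-proj ev-comp ev-prec-zero ev-prec-suc ev-μ evs-[] evs-∷ nz-zero nz-suc thm-self ref-self :
        Clause

  lt-zero = ∀[ 1 ] lt , 0ᵉ , sucᵉ x₀ , 0ᵉ :- []
  lt-suc = ∀[ 2 ] lt , sucᵉ x₀ , sucᵉ x₁ , 0ᵉ :- (lt , x₀ , x₁ , 0ᵉ) ∷ []

  nth-zero = ∀[ 2 ] nth , x₀ ∷ᵉ x₁ , 0ᵉ , x₀ :- []
  nth-suc = ∀[ 4 ] nth , x₀ ∷ᵉ x₁ , sucᵉ x₂ , x₃ :- (nth , x₁ , x₂ , x₃) ∷ []

  num-zero = ∀[ 0 ] numˢ , 0ᵉ , tagged 1 0ᵉ , 0ᵉ :- []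
  num-suc = ∀[ 2 ] numˢ , sucᵉ x₀ , tagged 2 x₁ , 0ᵉ :- (numˢ , x₀ , x₁ , 0ᵉ) ∷ []

  look-shift = ∀[ 2 ] look , shiftˣ x₀ , x₁ , tagged 0 (sucᵉ x₁) :- (lt , x₁ , x₀ , 0ᵉ) ∷ []
  look-single-zero = ∀[ 2 ] look , singleˣ x₀ x₁ , 0ᵉ , x₁ :- []
  look-single-suc = ∀[ 3 ] look , singleˣ x₀ x₁ , sucᵉ x₂ , tagged 0 x₂ :- (lt , x₂ , x₀ , 0ᵉ) ∷ []
  look-lift-zero = ∀[ 2 ] look , liftˣ x₀ x₁ , 0ᵉ , tagged 0 0ᵉ :- []
  -- x₄ is the value before the lift and x₃ its weakening; renaming is expressed as substitution
  -- along a shift.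
  look-lift-suc = ∀[ 5 ] look , liftˣ x₀ x₁ , sucᵉ x₂ , x₃ :- (look , prᵉ x₀ x₁ , x₂ , x₄) ∷
      (subT , shiftˣ x₀ , x₄ , x₃) ∷ []

  subT-var = ∀[ 3 ] subT , x₀ , tagged 0 x₁ , x₂ :- (look , x₀ , x₁ , x₂) ∷ []
  subT-zero = ∀[ 1 ] subT , x₀ , tagged 1 0ᵉ , tagged 1 0ᵉ :- []
  subT-suc = ∀[ 3 ] subT , x₀ , tagged 2 x₁ , tagged 2 x₂ :- (subT , x₀ , x₁ , x₂) ∷ []
  subT-+ = ∀[ 5 ] subT , x₀ , tagged₂ 3 x₁ x₂ , tagged₂ 3 x₃ x₄ :- (subT , x₀ , x₁ , x₃) ∷
      (subT , x₀ , x₂ , x₄) ∷ []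
  subT-· = ∀[ 5 ] subT , x₀ , tagged₂ 4 x₁ x₂ , tagged₂ 4 x₃ x₄ :- (subT , x₀ , x₁ , x₃) ∷
      (subT , x₀ , x₂ , x₄) ∷ []

  subF-⊥ = ∀[ 1 ] subF , x₀ , tagged 0 0ᵉ , tagged 0 0ᵉ :- []
  subF-≐ = ∀[ 5 ] subF , x₀ , tagged₂ 1 x₁ x₂ , tagged₂ 1 x₃ x₄ :- (subT , x₀ , x₁ , x₃) ∷
      (subT , x₀ , x₂ , x₄) ∷ []
  subF-≼ = ∀[ 5 ] subF , x₀ , tagged₂ 2 x₁ x₂ , tagged₂ 2 x₃ x₄ :- (subT , x₀ , x₁ , x₃) ∷
      (subT , x₀ , x₂ , x₄) ∷ []
  subF-⇒ = ∀[ 5 ] subF , x₀ , tagged₂ 3 x₁ x₂ , tagged₂ 3 x₃ x₄ :- (subF , x₀ , x₁ , x₃) ∷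
      (subF , x₀ , x₂ , x₄) ∷ []
  subF-∀ = ∀[ 4 ] subF , prᵉ x₀ x₁ , tagged 4 x₂ , tagged 4 x₃ :- (subF , liftˣ x₀ x₁ , x₂ , x₃) ∷ []

  wk-[] = ∀[ 1 ] wk , x₀ , 0ᵉ , 0ᵉ :- []
  wk-∷ = ∀[ 5 ] wk , x₀ , x₁ ∷ᵉ x₂ , x₃ ∷ᵉ x₄ :- (subF , shiftˣ x₀ , x₁ , x₃) ∷ (wk , x₀ , x₂ , x₄) ∷ []

  -- A premise subT or subF with shiftˣ says that its argument is a term or formula.
  prov-axiom = ∀[ 4 ] prov , x₀ , x₁ , x₂ :- (ev , conᵉ axioms , x₃ ∷ᵉ 0ᵉ , conᵉ 1) ∷
      (subF , emptyˣ x₀ , x₃ , x₂) ∷ []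
  prov-hyp = ∀[ 4 ] prov , x₀ , x₁ , x₂ :- (nth , x₁ , x₃ , x₂) ∷ []
  prov-⇒I = ∀[ 5 ] prov , x₀ , x₁ , tagged₂ 3 x₂ x₃ :- (subF , shiftˣ x₀ , x₂ , x₄) ∷
      (prov , x₀ , x₂ ∷ᵉ x₁ , x₃) ∷ []
  prov-⇒E = ∀[ 4 ] prov , x₀ , x₁ , x₂ :- (prov , x₀ , x₁ , tagged₂ 3 x₃ x₂) ∷ (prov , x₀ , x₁ , x₃) ∷ []
  prov-raa = ∀[ 4 ] prov , x₀ , x₁ , x₂ :- (subF , shiftˣ x₀ , x₂ , x₃) ∷
      (prov , x₀ , tagged₂ 3 x₂ (tagged 0 0ᵉ) ∷ᵉ x₁ , tagged 0 0ᵉ) ∷ []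
  prov-∀I = ∀[ 4 ] prov , x₀ , x₁ , tagged 4 x₂ :- (wk , x₀ , x₁ , x₃) ∷ (prov , sucᵉ x₀ , x₃ , x₂) ∷ []
  prov-∀E = ∀[ 6 ] prov , x₀ , x₁ , x₂ :- (prov , x₀ , x₁ , tagged 4 x₃) ∷ (subT , shiftˣ x₀ , x₄ , x₅) ∷
      (subF , singleˣ x₀ x₄ , x₃ , x₂) ∷ []
  prov-≐I = ∀[ 4 ] prov , x₀ , x₁ , tagged₂ 1 x₂ x₂ :- (subT , shiftˣ x₀ , x₂ , x₃) ∷ []
  prov-≐E = ∀[ 7 ] prov , x₀ , x₁ , x₂ :- (prov , x₀ , x₁ , tagged₂ 1 x₃ x₄) ∷
      (subF , singleˣ x₀ x₃ , x₅ , varᵉ (# 6)) ∷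
                                  (prov , x₀ , x₁ , varᵉ (# 6)) ∷ (subF , singleˣ x₀ x₄ , x₅ , x₂) ∷ []

  ev-zero = ∀[ 0 ] ev , tagged 0 0ᵉ , 0ᵉ , 0ᵉ :- []
  ev-suc = ∀[ 1 ] ev , tagged 1 0ᵉ , x₀ ∷ᵉ 0ᵉ , sucᵉ x₀ :- []
  ev-proj = ∀[ 3 ] ev , tagged 2 x₀ , x₁ , x₂ :- (nth , x₁ , x₀ , x₂) ∷ []
  ev-comp = ∀[ 5 ] ev , tagged₂ 3 x₀ x₁ , x₂ , x₃ :- (evs , x₁ , x₂ , x₄) ∷ (ev , x₀ , x₄ , x₃) ∷ []
  ev-prec-zero = ∀[ 4 ] ev , tagged₂ 4 x₀ x₁ , 0ᵉ ∷ᵉ x₂ , x₃ :- (ev , x₀ , x₂ , x₃) ∷ []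
  ev-prec-suc = ∀[ 6 ] ev , tagged₂ 4 x₀ x₁ , sucᵉ x₂ ∷ᵉ x₃ , x₄ :- (ev , tagged₂ 4 x₀ x₁ , x₂ ∷ᵉ x₃ , x₅) ∷
      (ev , x₁ , x₂ ∷ᵉ x₅ ∷ᵉ x₃ , x₄) ∷ []
  ev-μ = ∀[ 3 ] ev , tagged 5 x₀ , x₁ , x₂ :- (nz , x₀ , x₁ , x₂) ∷ (ev , x₀ , x₂ ∷ᵉ x₁ , 0ᵉ) ∷ []

  evs-[] = ∀[ 1 ] evs , 0ᵉ , x₀ , 0ᵉ :- []
  evs-∷ = ∀[ 5 ] evs , x₀ ∷ᵉ x₁ , x₂ , x₃ ∷ᵉ x₄ :- (ev , x₀ , x₂ , x₃) ∷ (evs , x₁ , x₂ , x₄) ∷ []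

  -- The rule for μ has a premise for every i < k, which no finite Horn body can list; `nz` replaces
  -- it by a recursion on k.
  nz-zero = ∀[ 2 ] nz , x₀ , x₁ , 0ᵉ :- []
  nz-suc = ∀[ 4 ] nz , x₀ , x₁ , sucᵉ x₂ :- (nz , x₀ , x₁ , x₂) ∷ (ev , x₀ , x₂ ∷ᵉ x₁ , sucᵉ x₃) ∷ []

  thm-self = ∀[ 3 ] thm , x₀ , 0ᵉ , 0ᵉ :- (numˢ , x₀ , x₁ , 0ᵉ) ∷ (subF , singleˣ 0ᵉ x₁ , x₀ , x₂) ∷
      (prov , 0ᵉ , 0ᵉ , x₂) ∷ []
  ref-self = ∀[ 3 ] ref , x₀ , 0ᵉ , 0ᵉ :- (numˢ , x₀ , x₁ , 0ᵉ) ∷ (subF , singleˣ 0ᵉ x₁ , x₀ , x₂) ∷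
      (prov , 0ᵉ , 0ᵉ , tagged₂ 3 x₂ (tagged 0 0ᵉ)) ∷ []

  program : Program
  program =
    lt-zero ∷ lt-suc ∷ nth-zero ∷ nth-suc ∷ num-zero ∷ num-suc ∷ look-shift ∷ look-single-zero ∷
        look-single-suc ∷ look-lift-zero ∷ look-lift-suc ∷
    subT-var ∷ subT-zero ∷ subT-suc ∷ subT-+ ∷ subT-· ∷ subF-⊥ ∷ subF-≐ ∷ subF-≼ ∷ subF-⇒ ∷ subF-∀ ∷ wk-[] ∷
        wk-∷ ∷
    prov-axiom ∷ prov-hyp ∷ prov-⇒I ∷ prov-⇒E ∷ prov-raa ∷ prov-∀I ∷ prov-∀E ∷ prov-≐I ∷ prov-≐E ∷
    ev-zero ∷ ev-suc ∷ ev-proj ∷ ev-comp ∷ ev-prec-zero ∷ ev-prec-suc ∷ ev-μ ∷ evs-[] ∷ evs-∷ ∷ nz-zero ∷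
        nz-suc ∷ thm-self ∷ ref-self ∷ []

  -- Completeness: true facts are derivable.

  D : ℕ → ℕ → ℕ → ℕ → Set
  D τ a b c = Derivable program (τ , a , b , c)

  clause : ∀ i (v : Vec ℕ (arity (lookupˡ program i))) →
    All (λ a → Derivable program (⟦ a ⟧ᵃ (lookup v))) (body (lookupˡ program i)) →
    Derivable program (⟦ head (lookupˡ program i) ⟧ᵃ (lookup v))
  clause i = fire (∈-lookup i)

  lt-complete : ∀ {n} (i : Fin n) → D lt (toℕ i) n 0
  lt-complete zero    = clause (# 0) (_ ∷ []) []
  lt-complete (suc i) = clause (# 1) (_ ∷ _ ∷ []) (lt-complete i ∷ [])

  num-complete : ∀ k → D numˢ k (termCode (num {0} k)) 0
  num-complete zero    = clause (# 4) [] []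
  num-complete (suc k) = clause (# 5) (_ ∷ _ ∷ []) (num-complete k ∷ [])

  private
    -- Relative to `look`, which breaks a cycle: looking up a variable in a lifted environment
    -- requires `subT` for a shift, while looking up in a shift requires only `lt`.
    subT-complete′ : ∀ {m n} (e : Env m n) → (∀ i → D look (envCode e) (toℕ i) (termCode (⟦ e ⟧ˢ i))) →
      ∀ t → D subT (envCode e) (termCode t) (termCode (substᵗ ⟦ e ⟧ˢ t))
    subT-complete′ e h (var i)  = clause (# 11) (_ ∷ _ ∷ _ ∷ []) (h i ∷ [])
    subT-complete′ e h zeroᵗ    = clause (# 12) (_ ∷ []) []
    subT-complete′ e h (sucᵗ t) = clause (# 13) (_ ∷ _ ∷ _ ∷ []) (subT-complete′ e h t ∷ [])
    subT-complete′ e h (s +ᵗ t) = clause (# 14) (_ ∷ _ ∷ _ ∷ _ ∷ _ ∷ [])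
        (subT-complete′ e h s ∷ subT-complete′ e h t ∷ [])
    subT-complete′ e h (s ·ᵗ t) = clause (# 15) (_ ∷ _ ∷ _ ∷ _ ∷ _ ∷ [])
        (subT-complete′ e h s ∷ subT-complete′ e h t ∷ [])

    look-complete-shift : ∀ {n} (i : Fin n) → D look (envCode (shiftᵉ {n})) (toℕ i) (termCode (var (suc i)))
    look-complete-shift {n} i = clause (# 6) (n ∷ toℕ i ∷ []) (lt-complete i ∷ [])

  isTerm : ∀ {n} (t : Term n) → D subT (envCode (shiftᵉ {n})) (termCode t) (termCode (renameᵗ suc t))
  isTerm t = transport (λ u → D subT (envCode shiftᵉ) (termCode t) (termCode u))
    (sym (renameᵗ≡substᵗ suc t)) (subT-complete′ shiftᵉ look-complete-shift t)

  look-complete : ∀ {m n} (e : Env m n) i → D look (envCode e) (toℕ i) (termCode (⟦ e ⟧ˢ i))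
  look-complete shiftᵉ      i       = look-complete-shift i
  look-complete (singleᵉ t) zero    = clause (# 7) (_ ∷ _ ∷ []) []
  look-complete (singleᵉ t) (suc i) = clause (# 8) (_ ∷ _ ∷ _ ∷ []) (lt-complete i ∷ [])
  look-complete (liftᵉ e)   zero    = clause (# 9) (_ ∷ _ ∷ []) []
  look-complete (liftᵉ e)   (suc i) = clause (# 10) (_ ∷ _ ∷ _ ∷ _ ∷ _ ∷ [])
      (look-complete e i ∷ isTerm (⟦ e ⟧ˢ i) ∷ [])

  subT-complete : ∀ {m n} (e : Env m n) t → D subT (envCode e) (termCode t) (termCode (substᵗ ⟦ e ⟧ˢ t))
  subT-complete e = subT-complete′ e (look-complete e)

  subF-complete : ∀ {m n} (e : Env m n) φ → D subF (envCode e) (formulaCode φ) (formulaCode (subst ⟦ e ⟧ˢ φ))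
  subF-complete e ⊥̇       = clause (# 16) (_ ∷ []) []
  subF-complete e (s ≐ t) = clause (# 17) (_ ∷ _ ∷ _ ∷ _ ∷ _ ∷ []) (subT-complete e s ∷ subT-complete e t ∷ [])
  subF-complete e (s ≼ t) = clause (# 18) (_ ∷ _ ∷ _ ∷ _ ∷ _ ∷ []) (subT-complete e s ∷ subT-complete e t ∷ [])
  subF-complete e (φ ⇒ ψ) = clause (# 19) (_ ∷ _ ∷ _ ∷ _ ∷ _ ∷ []) (subF-complete e φ ∷ subF-complete e ψ ∷ [])
  subF-complete e (∀̇ φ)   = clause (# 20) (_ ∷ _ ∷ _ ∷ _ ∷ []) (subF-complete (liftᵉ e) φ ∷ [])

  isFormula : ∀ {n} (φ : Formula n) → D subF (envCode (shiftᵉ {n})) (formulaCode φ) (formulaCode (weaken φ))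
  isFormula φ = transport (λ ψ → D subF (envCode shiftᵉ) (formulaCode φ) (formulaCode ψ))
    (sym (rename≡subst suc φ)) (subF-complete shiftᵉ φ)

  wk-complete : ∀ {n} (Γ : List (Formula n)) → D wk n (contextCode Γ) (contextCode (map weaken Γ))
  wk-complete []      = clause (# 21) (_ ∷ []) []
  wk-complete (φ ∷ Γ) = clause (# 22) (_ ∷ _ ∷ _ ∷ _ ∷ _ ∷ []) (isFormula φ ∷ wk-complete Γ ∷ [])

  mutual
    ev-complete : ∀ {n} {f : Code n} {v y} → f ⟨ v ⟩↓ y → D ev (codeCode f) (vecCode v) y
    ev-complete ↓zero           = clause (# 32) [] []
    ev-complete ↓suc            = clause (# 33) (_ ∷ []) []
    ev-complete (↓proj {xs = v} i) = clause (# 34) (_ ∷ _ ∷ _ ∷ []) (nth-toList v i ∷ [])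
    ev-complete (↓comp d e)     = clause (# 35) (_ ∷ _ ∷ _ ∷ _ ∷ _ ∷ []) (evs-complete d ∷ ev-complete e ∷ [])
    ev-complete (↓prec-zero d)  = clause (# 36) (_ ∷ _ ∷ _ ∷ _ ∷ []) (ev-complete d ∷ [])
    ev-complete (↓prec-suc d e) = clause (# 37) (_ ∷ _ ∷ _ ∷ _ ∷ _ ∷ _ ∷ [])
        (ev-complete d ∷ ev-complete e ∷ [])
    ev-complete (↓μ {k = k} h d) = clause (# 38) (_ ∷ _ ∷ _ ∷ []) (nz-complete k h ∷ ev-complete d ∷ [])

    evs-complete : ∀ {n m} {gs : Vec (Code n) m} {v ys} → gs ⟨ v ⟩⇊ ys →
        D evs (codesCode gs) (vecCode v) (vecCode ys)
    evs-complete []       = clause (# 39) (_ ∷ []) []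
    evs-complete (d ∷ ds) = clause (# 40) (_ ∷ _ ∷ _ ∷ _ ∷ _ ∷ []) (ev-complete d ∷ evs-complete ds ∷ [])

    nz-complete : ∀ {n} {f : Code (suc n)} {v} k → (∀ i → i < k → ∃ λ y → f ⟨ i ∷ v ⟩↓ suc y) →
        D nz (codeCode f) (vecCode v) k
    nz-complete zero    h = clause (# 41) (_ ∷ _ ∷ []) []
    nz-complete (suc k) h with h k (s≤s ≤-refl)
    ... | y , d = clause (# 42) (_ ∷ _ ∷ _ ∷ y ∷ []) (nz-complete k (λ i i<k → h i (m≤n⇒m≤1+n i<k)) ∷
        ev-complete d ∷ [])

    nth-toList : ∀ {n} (v : Vec ℕ n) i → D nth (vecCode v) (toℕ i) (lookup v i)
    nth-toList (x ∷ v) zero    = clause (# 2) (_ ∷ _ ∷ []) []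
    nth-toList (x ∷ v) (suc i) = clause (# 3) (_ ∷ _ ∷ _ ∷ _ ∷ []) (nth-toList v i ∷ [])

  module _ {A : Theory} (axioms-complete : ∀ σ → A σ → D ev axioms (suc (pr (formulaCode σ) 0)) 1) where

    nth-∈ : ∀ {n} {φ : Formula n} {Γ} → φ ∈ Γ → ∃ λ i → D nth (contextCode Γ) i (formulaCode φ)
    nth-∈ (here refl) = 0 , clause (# 2) (_ ∷ _ ∷ []) []
    nth-∈ (there p) with nth-∈ p
    ... | i , d = suc i , clause (# 3) (_ ∷ _ ∷ _ ∷ _ ∷ []) (d ∷ [])

    prov-complete : ∀ {n Γ} {φ : Formula n} → A ∣ Γ ⊢ φ → D prov n (contextCode Γ) (formulaCode φ)
    prov-complete (axiom {σ} a) = clause (# 23) (_ ∷ _ ∷ _ ∷ formulaCode σ ∷ []) (axioms-complete σ a ∷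
      transport (λ ψ → D subF (envCode emptyᵉ) (formulaCode σ) (formulaCode ψ)) (sym (embed≡subst _ σ))
          (subF-complete emptyᵉ σ) ∷ [])
    prov-complete (hyp p) with nth-∈ p
    ... | i , d = clause (# 24) (_ ∷ _ ∷ _ ∷ i ∷ []) (d ∷ [])
    prov-complete (⇒I {φ} d) = clause (# 25) (_ ∷ _ ∷ _ ∷ _ ∷ _ ∷ []) (isFormula φ ∷ prov-complete d ∷ [])
    prov-complete (⇒E d e) = clause (# 26) (_ ∷ _ ∷ _ ∷ _ ∷ []) (prov-complete d ∷ prov-complete e ∷ [])
    prov-complete (raa {φ} d) = clause (# 27) (_ ∷ _ ∷ _ ∷ _ ∷ []) (isFormula φ ∷ prov-complete d ∷ [])
    prov-complete (∀I {φ} d) = clause (# 28) (_ ∷ _ ∷ _ ∷ _ ∷ []) (wk-complete _ ∷ prov-complete d ∷ [])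
    prov-complete (∀E {φ} d t) = clause (# 29) (_ ∷ _ ∷ _ ∷ _ ∷ _ ∷ _ ∷ [])
        (prov-complete d ∷ isTerm t ∷ subF-complete (singleᵉ t) φ ∷ [])
    prov-complete (≐I t) = clause (# 30) (_ ∷ _ ∷ _ ∷ _ ∷ []) (isTerm t ∷ [])
    prov-complete (≐E {s} {t} φ d e) = clause (# 31) (_ ∷ _ ∷ _ ∷ _ ∷ _ ∷ _ ∷ _ ∷ [])
      (prov-complete d ∷ subF-complete (singleᵉ s) φ ∷ prov-complete e ∷ subF-complete (singleᵉ t) φ ∷ [])

    thm-complete : ∀ φ → A ⊢ φ [ num (formulaCode φ) ] → D thm (formulaCode φ) 0 0
    thm-complete φ d = clause (# 43) (_ ∷ _ ∷ _ ∷ []) (num-complete _ ∷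
        subF-complete (singleᵉ (num (formulaCode φ))) φ ∷ prov-complete d ∷ [])

    ref-complete : ∀ φ → A ⊢ ¬̇ φ [ num (formulaCode φ) ] → D ref (formulaCode φ) 0 0
    ref-complete φ d = clause (# 44) (_ ∷ _ ∷ _ ∷ []) (num-complete _ ∷
        subF-complete (singleᵉ (num (formulaCode φ))) φ ∷ prov-complete d ∷ [])

-- Injectivity and inversion of codes.

termCode-injective : ∀ {n} (s t : Term n) → termCode s ≡ termCode t → s ≡ t
termArgs-injective : ∀ {n} (s t : Term n) → termTag s ≡ termTag t → termArgs s ≡ termArgs t → s ≡ t

termCode-injective s t eq = termArgs-injective s t (proj₁ (pr-injective eq)) (proj₂ (pr-injective eq))

termArgs-injective (var i)   (var j)   refl eq = cong var (toℕ-injective eq)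
termArgs-injective zeroᵗ     zeroᵗ     refl eq = refl
termArgs-injective (sucᵗ s)  (sucᵗ t)  refl eq = cong sucᵗ (termCode-injective s t eq)
termArgs-injective (s +ᵗ s′) (t +ᵗ t′) refl eq = cong₂ _+ᵗ_
  (termCode-injective s t (proj₁ (pr-injective eq))) (termCode-injective s′ t′ (proj₂ (pr-injective eq)))
termArgs-injective (s ·ᵗ s′) (t ·ᵗ t′) refl eq = cong₂ _·ᵗ_
  (termCode-injective s t (proj₁ (pr-injective eq))) (termCode-injective s′ t′ (proj₂ (pr-injective eq)))

formulaCode-injective : ∀ {n} (φ ψ : Formula n) → formulaCode φ ≡ formulaCode ψ → φ ≡ ψ
formulaArgs-injective : ∀ {n} (φ ψ : Formula n) → formulaTag φ ≡ formulaTag ψ → formulaArgs φ ≡ formulaArgs ψ →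
    φ ≡ ψ

formulaCode-injective φ ψ eq = formulaArgs-injective φ ψ (proj₁ (pr-injective eq)) (proj₂ (pr-injective eq))

formulaArgs-injective ⊥̇        ⊥̇        refl eq = refl
formulaArgs-injective (s ≐ s′) (t ≐ t′) refl eq = cong₂ _≐_
  (termCode-injective s t (proj₁ (pr-injective eq))) (termCode-injective s′ t′ (proj₂ (pr-injective eq)))
formulaArgs-injective (s ≼ s′) (t ≼ t′) refl eq = cong₂ _≼_
  (termCode-injective s t (proj₁ (pr-injective eq))) (termCode-injective s′ t′ (proj₂ (pr-injective eq)))
formulaArgs-injective (φ ⇒ φ′) (ψ ⇒ ψ′) refl eq = cong₂ _⇒_
  (formulaCode-injective φ ψ (proj₁ (pr-injective eq))) (formulaCode-injective φ′ ψ′ (proj₂ (pr-injective eq)))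
formulaArgs-injective (∀̇ φ)    (∀̇ ψ)    refl eq = cong ∀̇_ (formulaCode-injective φ ψ eq)

⇒-inversion : ∀ {n a b} (χ : Formula n) → formulaCode χ ≡ pr 3 (pr a b) →
  ∃ λ φ → ∃ λ ψ → χ ≡ (φ ⇒ ψ) × formulaCode φ ≡ a × formulaCode ψ ≡ b
⇒-inversion χ eq with χ | pr-injective eq
... | φ ⇒ ψ | refl , args = φ , ψ , refl , pr-injective args

≐-inversion : ∀ {n a b} (χ : Formula n) → formulaCode χ ≡ pr 1 (pr a b) →
  ∃ λ s → ∃ λ t → χ ≡ (s ≐ t) × termCode s ≡ a × termCode t ≡ b
≐-inversion χ eq with χ | pr-injective eq
... | s ≐ t | refl , args = s , t , refl , pr-injective args

∀-inversion : ∀ {n a} (χ : Formula n) → formulaCode χ ≡ pr 4 a →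
  ∃ λ φ → χ ≡ (∀̇ φ) × formulaCode φ ≡ a
∀-inversion χ eq with χ | pr-injective eq
... | ∀̇ φ | refl , args = φ , refl , args

env-inversion : ∀ {m n n′ t a} (e : Env m n) → envCode e ≡ pr n′ (pr t a) → n ≡ n′ × envTag e ≡ t ×
    envArgs e ≡ a
env-inversion e eq = proj₁ (pr-injective eq) , pr-injective (proj₂ (pr-injective eq))

∷-inversion : ∀ {x y l m} → suc (pr x l) ≡ suc (pr y m) → x ≡ y × l ≡ m
∷-inversion eq = pr-injective (suc-injective eq)

data At : List ℕ → ℕ → ℕ → Set where
  here  : ∀ {x l} → At (x ∷ l) 0 x
  there : ∀ {x y l i} → At l i y → At (x ∷ l) (suc i) y

At⇒∈ : ∀ {l i x} → At l i x → x ∈ l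
At⇒∈ here      = here refl
At⇒∈ (there p) = there (At⇒∈ p)

At-lookup : ∀ {n x} (v : Vec ℕ n) i → At (toList v) (toℕ i) x → lookup v i ≡ x
At-lookup (y ∷ v) zero    here      = refl
At-lookup (y ∷ v) (suc i) (there p) = At-lookup v i p

-- Soundness: derivable facts are true.

module Soundness (A : Theory) (f : Code 1)
  (axioms-sound : ∀ c → (∀ z → f ⟨ c ∷ [] ⟩↓ z → z ≡ 1) → ∃ λ σ → A σ × formulaCode σ ≡ c) where

  open Provability (codeCode f)

  -- ev excludes all other values; as f is total, this is enough.
  Meaning : Fact → Set
  Meaning (lt   , i  , n  , _ ) = ∃ λ (k : Fin n) → toℕ k ≡ i
  Meaning (nth  , xs , i  , x ) = ∀ l → listCode l ≡ xs → At l i x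
  Meaning (numˢ , k  , t  , _ ) = termCode (num {0} k) ≡ t
  Meaning (look , e  , i  , t ) = ∀ {m n} (ε : Env m n) → envCode ε ≡ e →
    ∃ λ k → toℕ k ≡ i × termCode (⟦ ε ⟧ˢ k) ≡ t
  Meaning (subT , e  , s  , t ) = ∀ {m n} (ε : Env m n) → envCode ε ≡ e →
    ∃ λ u → termCode u ≡ s × termCode (substᵗ ⟦ ε ⟧ˢ u) ≡ t
  Meaning (subF , e  , a  , b ) = ∀ {m n} (ε : Env m n) → envCode ε ≡ e →
    ∃ λ φ → formulaCode φ ≡ a × formulaCode (subst ⟦ ε ⟧ˢ φ) ≡ b
  Meaning (wk   , n  , g  , g′) = ∀ (Γ : List (Formula n)) → contextCode Γ ≡ g → contextCode (map weaken Γ) ≡ g′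
  Meaning (prov , n  , g  , a ) = ∀ (Γ : List (Formula n)) → contextCode Γ ≡ g → ∃ λ φ → formulaCode φ ≡ a ×
      (A ∣ Γ ⊢ φ)
  Meaning (ev   , c  , xs , y ) = ∀ {n} (h : Code n) v z → codeCode h ≡ c → vecCode v ≡ xs → (h ⟨ v ⟩↓ z) →
      z ≡ y
  Meaning (evs  , c  , xs , ys) = ∀ {n m} (hs : Vec (Code n) m) v zs → codesCode hs ≡ c → vecCode v ≡ xs →
      (hs ⟨ v ⟩⇊ zs) → vecCode zs ≡ ys
  Meaning (nz   , c  , xs , k ) = ∀ {n} (h : Code (suc n)) v → codeCode h ≡ c → vecCode v ≡ xs → ∀ i → i < k →
      ¬ (h ⟨ i ∷ v ⟩↓ 0)
  Meaning (thm  , a  , _  , _ ) = ∀ φ → formulaCode φ ≡ a → A ⊢ φ [ num a ]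
  Meaning (ref  , a  , _  , _ ) = ∀ φ → formulaCode φ ≡ a → A ⊢ ¬̇ φ [ num a ]
  Meaning (_    , _  , _  , _ ) = ⊥

  -- Clauses fire on arbitrary numbers, also on those that code nothing. The meanings therefore
  -- assume that environments, contexts and recursive functions are given in decoded form; the terms
  -- and formulas then come out decoded, which is how a derivation in the calculus is rebuilt.
  Sound : Clause → Set
  Sound C = ∀ v → All (λ a → Meaning (⟦ a ⟧ᵃ (lookup v))) (body C) → Meaning (⟦ head C ⟧ᵃ (lookup v))

  private
    nth-zero-sound : Sound nth-zero
    nth-zero-sound (x ∷ xs ∷ []) [] (y ∷ l) eq with ∷-inversion eq
    ... | refl , _ = here

    nth-suc-sound : Sound nth-suc
    nth-suc-sound (x ∷ xs ∷ i ∷ y ∷ []) (p ∷ []) (_ ∷ l) eq = there (p l (proj₂ (∷-inversion eq)))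

    look-shift-sound : Sound look-shift
    look-shift-sound (n ∷ i ∷ []) ((k , refl) ∷ []) ε eq with env-inversion ε eq
    ... | refl , tag , _ with ε | tag
    ... | shiftᵉ | refl = k , refl , refl

    look-single-zero-sound : Sound look-single-zero
    look-single-zero-sound (n ∷ t ∷ []) [] ε eq with env-inversion ε eq
    ... | refl , tag , args with ε | tag
    ... | singleᵉ t | refl = zero , refl , args

    look-single-suc-sound : Sound look-single-suc
    look-single-suc-sound (n ∷ t ∷ i ∷ []) ((k , refl) ∷ []) ε eq with env-inversion ε eq
    ... | refl , tag , args with ε | tag
    ... | singleᵉ t | refl = suc k , refl , refl

    look-lift-zero-sound : Sound look-lift-zero
    look-lift-zero-sound (n ∷ e ∷ []) [] ε eq with env-inversion ε eq
    ... | refl , tag , args with ε | tag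
    ... | liftᵉ ε | refl = zero , refl , refl

    look-lift-suc-sound : Sound look-lift-suc
    look-lift-suc-sound (n ∷ e ∷ i ∷ t ∷ u ∷ []) (p ∷ q ∷ []) ε eq with env-inversion ε eq
    ... | refl , tag , args with ε | tag
    ... | liftᵉ ε | refl with p ε args | q (shiftᵉ {n}) refl
    ... | k , refl , refl | u , eq′ , refl with termCode-injective u (⟦ ε ⟧ˢ k) eq′
    ... | refl = suc k , refl , cong termCode (renameᵗ≡substᵗ suc (⟦ ε ⟧ˢ k))

    subT-var-sound : Sound subT-var
    subT-var-sound (e ∷ i ∷ t ∷ []) (p ∷ []) ε eq with p ε eq
    ... | k , refl , refl = var k , refl , refl

    subT-suc-sound : Sound subT-suc
    subT-suc-sound (e ∷ s ∷ t ∷ []) (p ∷ []) ε eq with p ε eq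
    ... | u , refl , refl = sucᵗ u , refl , refl

    subT-+-sound : Sound subT-+
    subT-+-sound (e ∷ s ∷ s′ ∷ t ∷ t′ ∷ []) (p ∷ q ∷ []) ε eq with p ε eq | q ε eq
    ... | u , refl , refl | u′ , refl , refl = u +ᵗ u′ , refl , refl

    subT-·-sound : Sound subT-·
    subT-·-sound (e ∷ s ∷ s′ ∷ t ∷ t′ ∷ []) (p ∷ q ∷ []) ε eq with p ε eq | q ε eq
    ... | u , refl , refl | u′ , refl , refl = u ·ᵗ u′ , refl , refl

    subF-≐-sound : Sound subF-≐
    subF-≐-sound (e ∷ s ∷ s′ ∷ t ∷ t′ ∷ []) (p ∷ q ∷ []) ε eq with p ε eq | q ε eq
    ... | u , refl , refl | u′ , refl , refl = (u ≐ u′) , refl , refl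

    subF-≼-sound : Sound subF-≼
    subF-≼-sound (e ∷ s ∷ s′ ∷ t ∷ t′ ∷ []) (p ∷ q ∷ []) ε eq with p ε eq | q ε eq
    ... | u , refl , refl | u′ , refl , refl = (u ≼ u′) , refl , refl

    subF-⇒-sound : Sound subF-⇒
    subF-⇒-sound (e ∷ s ∷ s′ ∷ t ∷ t′ ∷ []) (p ∷ q ∷ []) ε eq with p ε eq | q ε eq
    ... | φ , refl , refl | ψ , refl , refl = (φ ⇒ ψ) , refl , refl

    subF-∀-sound : Sound subF-∀
    subF-∀-sound (n ∷ e ∷ a ∷ b ∷ []) (p ∷ []) ε eq with pr-injective eq
    ... | refl , refl with p (liftᵉ ε) refl
    ... | φ , refl , refl = (∀̇ φ) , refl , refl

    wk-∷-sound : Sound wk-∷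
    wk-∷-sound (n ∷ a ∷ g ∷ a′ ∷ g′ ∷ []) (p ∷ q ∷ []) (φ ∷ Γ) eq with ∷-inversion eq
    ... | refl , refl with p (shiftᵉ {n}) refl
    ... | ψ , eq′ , refl with formulaCode-injective ψ φ eq′
    ... | refl = cong₂ (λ x l → suc (pr x l)) (cong formulaCode (rename≡subst suc φ)) (q Γ refl)

    prov-axiom-sound : Sound prov-axiom
    prov-axiom-sound (n ∷ g ∷ a ∷ c ∷ []) (p ∷ q ∷ []) Γ eq with axioms-sound c (λ z → p f (c ∷ []) z refl refl)
    ... | σ , Aσ , refl with q (emptyᵉ {n}) refl
    ... | τ , eq′ , refl with formulaCode-injective τ σ eq′
    ... | refl = embed σ , cong formulaCode (embed≡subst _ σ) , axiom Aσ

    prov-hyp-sound : Sound prov-hyp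
    prov-hyp-sound (n ∷ g ∷ a ∷ i ∷ []) (p ∷ []) Γ eq with ∈-map⁻ formulaCode (At⇒∈ (p (map formulaCode Γ) eq))
    ... | φ , φ∈Γ , refl = φ , refl , hyp φ∈Γ

    prov-⇒I-sound : Sound prov-⇒I
    prov-⇒I-sound (n ∷ g ∷ a ∷ b ∷ a′ ∷ []) (p ∷ q ∷ []) Γ refl with p (shiftᵉ {n}) refl
    ... | φ , refl , _ with q (φ ∷ Γ) refl
    ... | ψ , refl , d = (φ ⇒ ψ) , refl , ⇒I d

    prov-⇒E-sound : Sound prov-⇒E
    prov-⇒E-sound (n ∷ g ∷ b ∷ a ∷ []) (p ∷ q ∷ []) Γ eq with p Γ eq | q Γ eq
    ... | χ , eq′ , d | φ′ , refl , e with ⇒-inversion χ eq′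
    ... | φ , ψ , refl , eq″ , refl with formulaCode-injective φ φ′ eq″
    ... | refl = ψ , refl , ⇒E d e

    prov-raa-sound : Sound prov-raa
    prov-raa-sound (n ∷ g ∷ a ∷ a′ ∷ []) (p ∷ q ∷ []) Γ refl with p (shiftᵉ {n}) refl
    ... | φ , refl , _ with q (¬̇ φ ∷ Γ) refl
    ... | ψ , eq , d with formulaCode-injective ψ ⊥̇ eq
    ... | refl = φ , refl , raa d

    prov-∀I-sound : Sound prov-∀I
    prov-∀I-sound (n ∷ g ∷ a ∷ g′ ∷ []) (p ∷ q ∷ []) Γ eq with q (map weaken Γ) (p Γ eq)
    ... | φ , refl , d = (∀̇ φ) , refl , ∀I d

    prov-∀E-sound : Sound prov-∀E
    prov-∀E-sound (n ∷ g ∷ b ∷ a ∷ t ∷ t′ ∷ []) (p ∷ q ∷ r ∷ []) Γ eq with p Γ eq | q (shiftᵉ {n}) refl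
    ... | χ , eq′ , d | u , refl , _ with ∀-inversion χ eq′ | r (singleᵉ u) refl
    ... | φ , refl , eq″ | ψ , refl , refl with formulaCode-injective φ ψ eq″
    ... | refl = φ [ u ] , refl , ∀E d u

    prov-≐I-sound : Sound prov-≐I
    prov-≐I-sound (n ∷ g ∷ t ∷ t′ ∷ []) (p ∷ []) Γ eq with p (shiftᵉ {n}) refl
    ... | u , refl , _ = (u ≐ u) , refl , ≐I u

    prov-≐E-sound : Sound prov-≐E
    prov-≐E-sound (n ∷ g ∷ b ∷ s ∷ t ∷ c ∷ a ∷ []) (p ∷ q ∷ r ∷ q′ ∷ []) Γ eq with p Γ eq | r Γ eq
    ... | χ , eq′ , d | α , refl , e with ≐-inversion χ eq′
    ... | u , v , refl , refl , refl with q (singleᵉ u) refl | q′ (singleᵉ v) refl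
    ... | φ , refl , eq₁ | ψ , eq₂ , refl with formulaCode-injective ψ φ eq₂ | formulaCode-injective
        (φ [ u ]) α eq₁
    ... | refl | refl = φ [ v ] , refl , ≐E φ d e

    ev-zero-sound : Sound ev-zero
    ev-zero-sound [] [] h v z eq _ d with h | pr-injective eq
    ... | zeroᶜ | refl , _ with d
    ... | ↓zero = refl

    ev-suc-sound : Sound ev-suc
    ev-suc-sound (x ∷ []) [] h v z eq eq′ d with h | pr-injective eq
    ... | sucᶜ | refl , _ with d
    ... | ↓suc = cong suc (proj₁ (∷-inversion eq′))

    ev-proj-sound : Sound ev-proj
    ev-proj-sound (i ∷ xs ∷ y ∷ []) (p ∷ []) h v z eq eq′ d with h | pr-injective eq
    ... | proj i | refl , refl with d
    ... | ↓proj i = At-lookup v i (p (toList v) eq′)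

    ev-comp-sound : Sound ev-comp
    ev-comp-sound (g ∷ gs ∷ xs ∷ z ∷ ys ∷ []) (p ∷ q ∷ []) h v z′ eq eq′ d with h | pr-injective eq
    ... | comp g gs | refl , args with pr-injective args | d
    ... | refl , refl | ↓comp ds e = q g _ z′ refl (p gs v _ refl eq′ ds) e

    ev-prec-zero-sound : Sound ev-prec-zero
    ev-prec-zero-sound (g ∷ g′ ∷ xs ∷ y ∷ []) (p ∷ []) h v z eq eq′ d with h | pr-injective eq
    ... | prec g g′ | refl , args with pr-injective args | d
    ... | refl , refl | ↓prec-zero e  = p g _ z refl (proj₂ (∷-inversion eq′)) e
    ... | refl , refl | ↓prec-suc _ _ = case proj₁ (∷-inversion eq′) of λ ()

    ev-prec-suc-sound : Sound ev-prec-suc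
    ev-prec-suc-sound (g ∷ g′ ∷ k ∷ xs ∷ y ∷ y′ ∷ []) (p ∷ q ∷ []) h v z eq eq′ d with h | pr-injective eq
    ... | prec g g′ | refl , args with pr-injective args | d
    ... | refl , refl | ↓prec-zero _ = case proj₁ (∷-inversion eq′) of λ ()
    ... | refl , refl | ↓prec-suc {xs = v} e e′ with ∷-inversion eq′
    ... | refl , refl with p (prec g g′) (k ∷ v) _ refl refl e
    ... | refl = q g′ (k ∷ y′ ∷ v) z refl refl e′

    -- Soundness of `ev` amounts to determinism of evaluation. Here z is the actual result of the
    -- search and k the derived one: z < k contradicts `nz`, and k < z means that the search passed
    -- k with a positive value, although the value there can only be 0.
    ev-μ-sound : Sound ev-μ
    ev-μ-sound (g ∷ xs ∷ k ∷ []) (p ∷ q ∷ []) h v z eq eq′ d with h | pr-injective eq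
    ... | μ g | refl , refl with d | eq′
    ... | ↓μ least e | refl with <-cmp z k
    ... | tri≈ _ z≡k _ = z≡k
    ... | tri< z<k _ _ = ⊥-elim (p g v refl refl z z<k e)
    ... | tri> _ _ k<z with least k k<z
    ... | y , e′ = case q g (k ∷ v) (suc y) refl refl e′ of λ ()

    evs-∷-sound : Sound evs-∷
    evs-∷-sound (g ∷ gs ∷ xs ∷ y ∷ ys ∷ []) (p ∷ q ∷ []) (h ∷ hs) v (z ∷ zs) eq eq′ (d ∷ ds) with ∷-inversion eq
    ... | refl , refl = cong₂ (λ x l → suc (pr x l)) (p h v z refl eq′ d) (q hs v zs refl eq′ ds)

    nz-suc-sound : Sound nz-suc
    nz-suc-sound (g ∷ xs ∷ k ∷ y ∷ []) (p ∷ q ∷ []) h v refl refl i (s≤s i≤k) d with m≤n⇒m<n∨m≡n i≤k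
    ... | inj₁ i<k  = p h v refl refl i i<k d
    ... | inj₂ refl = case q h (i ∷ v) 0 refl refl d of λ ()

    thm-self-sound : Sound thm-self
    thm-self-sound (a ∷ t ∷ b ∷ []) (refl ∷ q ∷ r ∷ []) φ eq with q (singleᵉ (num a)) refl | r [] refl
    ... | φ′ , eq′ , eq₁ | ψ , eq₂ , d with formulaCode-injective φ′ φ (trans eq′ (sym eq))
    ... | refl with formulaCode-injective ψ (φ [ num a ]) (trans eq₂ (sym eq₁))
    ... | refl = d

    ref-self-sound : Sound ref-self
    ref-self-sound (a ∷ t ∷ b ∷ []) (refl ∷ q ∷ r ∷ []) φ eq with q (singleᵉ (num a)) refl | r [] refl
    ... | φ′ , eq′ , eq₁ | ψ , eq₂ , d with formulaCode-injective φ′ φ (trans eq′ (sym eq)) | ⇒-inversion ψ eq₂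
    ... | refl | χ , β , refl , eq₃ , eq₄ with formulaCode-injective χ (φ [ num a ])
        (trans eq₃ (sym eq₁)) | formulaCode-injective β ⊥̇ eq₄
    ... | refl | refl = d

    clauses-sound : All Sound program
    clauses-sound =
      (λ { (n ∷ []) [] → zero , refl }) ∷
      (λ { (i ∷ n ∷ []) ((k , refl) ∷ []) → suc k , refl }) ∷
      nth-zero-sound ∷ nth-suc-sound ∷
      (λ { [] [] → refl }) ∷
      (λ { (k ∷ t ∷ []) (refl ∷ []) → refl }) ∷
      look-shift-sound ∷ look-single-zero-sound ∷ look-single-suc-sound ∷ look-lift-zero-sound ∷
          look-lift-suc-sound ∷
      subT-var-sound ∷ (λ { (e ∷ []) [] ε eq → zeroᵗ , refl , refl }) ∷ subT-suc-sound ∷ subT-+-sound ∷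
          subT-·-sound ∷
      (λ { (e ∷ []) [] ε eq → ⊥̇ , refl , refl }) ∷ subF-≐-sound ∷ subF-≼-sound ∷ subF-⇒-sound ∷ subF-∀-sound ∷
      (λ { (n ∷ []) [] [] eq → refl }) ∷ wk-∷-sound ∷
      prov-axiom-sound ∷ prov-hyp-sound ∷ prov-⇒I-sound ∷ prov-⇒E-sound ∷ prov-raa-sound ∷ prov-∀I-sound ∷
          prov-∀E-sound ∷ prov-≐I-sound ∷ prov-≐E-sound ∷
      ev-zero-sound ∷ ev-suc-sound ∷ ev-proj-sound ∷ ev-comp-sound ∷ ev-prec-zero-sound ∷ ev-prec-suc-sound ∷
          ev-μ-sound ∷
      (λ { (xs ∷ []) [] [] v [] eq eq′ [] → refl }) ∷ evs-∷-sound ∷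
      (λ { (g ∷ xs ∷ []) [] h v eq eq′ i () }) ∷ nz-suc-sound ∷
      thm-self-sound ∷ ref-self-sound ∷ []

  derivable-sound  : ∀ {F} → Derivable program F → Meaning F
  derivables-sound : ∀ {k as} {v : Vec ℕ k} → All (λ a → Derivable program (⟦ a ⟧ᵃ (lookup v))) as →
      All (λ a → Meaning (⟦ a ⟧ᵃ (lookup v))) as

  derivable-sound (fire C∈P v ds) = All.lookup clauses-sound C∈P v (derivables-sound {v = v} ds)

  derivables-sound []               = []
  derivables-sound {v = v} (d ∷ ds) = derivable-sound d ∷ derivables-sound {v = v} ds

-- The undecided sentence and the conclusion.

-- Each quantified variable is at the same time the bound for all quantifiers of φ or ψ, so that
-- being a witness means making the formula true below oneself. The indices 1 and 2 refer to the one
-- free variable, seen from under one and two binders.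
rosserFormula : Formula 1 → Formula 1 → Formula 1
rosserFormula φ ψ = ∀̇ (bounded (var zero) (φ ⟨ var (suc zero) ⟩) ⇒
  ¬̇ ∀̇ (var zero ≼ var (suc zero) ⇒ ¬̇ bounded (var zero) (ψ ⟨ var (suc (suc zero)) ⟩)))

rosserFormula-[] : ∀ φ ψ r → rosserFormula φ ψ [ num r ] ≡
  rosser (bounded (var zero) (φ ⟨ num r ⟩)) (bounded (var zero) (ψ ⟨ num r ⟩))
rosserFormula-[] φ ψ r = cong₂ (λ α β → ∀̇ (α ⇒ ¬̇ ∀̇ (var zero ≼ var (suc zero) ⇒ ¬̇ β)))
  (trans (subst-bounded _ (var zero) (φ ⟨ var (suc zero) ⟩)) (cong (bounded (var zero))
    (trans (subst-⟨⟩ _ φ (var (suc zero))) (cong (φ ⟨_⟩) (renameᵗ-num suc r)))))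
  (trans (trans (subst-bounded _ (var zero) (ψ ⟨ var (suc (suc zero)) ⟩)) (cong (bounded (var zero))
    (trans (subst-⟨⟩ _ ψ (var (suc (suc zero)))) (cong (ψ ⟨_⟩)
      (trans (cong (renameᵗ suc) (renameᵗ-num suc r)) (renameᵗ-num suc r))))))
    (sym (trans (subst-bounded _ (var zero) (ψ ⟨ num r ⟩)) (cong (bounded (var zero))
      (trans (subst-⟨⟩ _ ψ (num r)) (cong (ψ ⟨_⟩) (substᵗ-num _ r)))))))

bounded-⟨⟩ : ∀ φ r w → bounded (var zero) (φ ⟨ num r ⟩) ⟨ num w ⟩ ≡ bounded (num {0} w)
    (subst (numerals (r ∷ [])) φ)
bounded-⟨⟩ φ r w = trans (subst-bounded _ (var zero) (φ ⟨ num r ⟩)) (cong (bounded (num w))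
  (trans (subst-⟨⟩ _ φ (num r)) (trans (cong (φ ⟨_⟩) (substᵗ-num _ r)) (subst-cong (λ { zero → refl }) φ))))

-- Thm and Ref speak of φ(⌜φ⌝), so that no diagonal lemma is needed.
module Incompleteness {T : Theory} (consistent : Consistent T) (Q⊆T : T Extends Q)
  {Thm Ref : Vec ℕ 1 → Set} (thmΣ : Σ₁ Thm) (refΣ : Σ₁ Ref)
  (thm⇔ : ∀ φ → (T ⊢ φ [ num (formulaCode φ) ]) ⇔ Thm (formulaCode φ ∷ []))
  (ref⇔ : ∀ φ → (T ⊢ ¬̇ φ [ num (formulaCode φ) ]) ⇔ Ref (formulaCode φ ∷ []))
  where

  open BoundedTruth Q⊆T

  private
    R : Formula 1
    R = rosserFormula (formula thmΣ) (formula refΣ)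

    r : ℕ
    r = formulaCode R

    α β : Formula 1
    α = bounded (var zero) (formula thmΣ ⟨ num r ⟩)
    β = bounded (var zero) (formula refΣ ⟨ num r ⟩)

    open Rosser Q⊆T α β

    R≡rosser : R [ num r ] ≡ rosser α β
    R≡rosser = rosserFormula-[] (formula thmΣ) (formula refΣ) r

    ⊢-instance : ∀ φ w → Sat w (r ∷ []) φ → T ⊢ bounded (var zero) (φ ⟨ num r ⟩) ⟨ num w ⟩
    ⊢-instance φ w s = transport (T ⊢_) (sym (bounded-⟨⟩ φ r w)) (Sat⇒⊢ w (r ∷ []) φ s)

    ⊢-¬instance : ∀ φ w → ¬ Sat w (r ∷ []) φ → T ⊢ ¬̇ bounded (var zero) (φ ⟨ num r ⟩) ⟨ num w ⟩
    ⊢-¬instance φ w ¬s = transport (λ χ → T ⊢ ¬̇ χ) (sym (bounded-⟨⟩ φ r w)) (¬Sat⇒⊢ w (r ∷ []) φ ¬s)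

    witness : ∀ {S : Vec ℕ 1 → Set} (s : Σ₁ S) → S (r ∷ []) → ∃ λ w → Sat w (r ∷ []) (formula s)
    witness s p with complete s (r ∷ []) p
    ... | w , h = w , h w ≤-refl

    -- Consistency enters twice: it makes every instance of β false, hence refutable in `T`, and it
    -- rejects the contradiction that `rosser-refutable` then derives.
    not-provable : ¬ (T ⊢ R [ num r ])
    not-provable d with witness thmΣ (Equivalence.to (thm⇔ R) d)
    ... | w , s = consistent (rosser-refutable w (⊢-instance (formula thmΣ) w s)
      (λ v → ⊢-¬instance (formula refΣ) v λ s′ →
        consistent (⇒E (Equivalence.from (ref⇔ R) (sound refΣ (r ∷ []) s′)) d))
      (transport (T ⊢_) R≡rosser d))

    not-refutable : ¬ (T ⊢ ¬̇ R [ num r ])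
    not-refutable e with witness refΣ (Equivalence.to (ref⇔ R) e)
    ... | v , s = consistent (⇒E (transport (λ σ → T ⊢ ¬̇ σ) R≡rosser e)
      (rosser-provable v (⊢-instance (formula refΣ) v s)
        (λ w → ⊢-¬instance (formula thmΣ) w λ s′ →
          consistent (⇒E e (Equivalence.from (thm⇔ R) (sound thmΣ (r ∷ []) s′))))))

  undecided : ∃ λ σ → ¬ (T ⊢ σ) × ¬ (T ⊢ ¬̇ σ)
  undecided = R [ num r ] , not-provable , not-refutable

-- Recursiveness concerns the axiom set `A`, so the program generates the theorems of `A`; the
-- equivalence `T⇔A` carries its completeness and soundness over to `T`, in which the arithmetic
-- takes place.
corollary5 : (T : Theory) → Consistent T → RecursivelyAxiomatizable T → T Extends Q →
    ∃ λ σ → ¬ (T ⊢ σ) × ¬ (T ⊢ ¬̇ σ)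
corollary5 T consistent (A , (f , f-decides) , T⇔A) Q⊆T =
  Incompleteness.undecided consistent Q⊆T
    (derivable-Σ₁ program {1} (thm , x₀ , 0ᵉ , 0ᵉ)) (derivable-Σ₁ program {1} (ref , x₀ , 0ᵉ , 0ᵉ))
    (λ φ → mk⇔ (λ d → thm-complete axioms-complete φ (Equivalence.to (T⇔A _) d))
               (λ d → Equivalence.from (T⇔A _) (derivable-sound d φ refl)))
    (λ φ → mk⇔ (λ d → ref-complete axioms-complete φ (Equivalence.to (T⇔A _) d))
               (λ d → Equivalence.from (T⇔A _) (derivable-sound d φ refl)))
  where
  open Provability (codeCode f)

  axioms-complete : ∀ σ → A σ → D ev (codeCode f) (suc (pr (formulaCode σ) 0)) 1
  axioms-complete σ Aσ with f-decides ⌜ σ ⌝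
  ... | inj₁ (_ , d)  = transport (λ c → D ev (codeCode f) (suc (pr c 0)) 1) (sym (formulaCode≡ σ))
      (ev-complete d)
  ... | inj₂ (¬p , _) = ⊥-elim (¬p (σ , Aσ , refl))

  axioms-sound : ∀ c → (∀ z → f ⟨ c ∷ [] ⟩↓ z → z ≡ 1) → ∃ λ σ → A σ × formulaCode σ ≡ c
  axioms-sound c h with f-decides c
  ... | inj₁ ((σ , Aσ , eq) , _) = σ , Aσ , trans (formulaCode≡ σ) eq
  ... | inj₂ (_ , d)             = case h 0 d of λ ()

  open Soundness A f axioms-sound
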